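{- All trees on $n$ vertices are maximal elements in the poset $\mathcal{E}_n$.
   Context: All graphs are finite and simple. The chromatic symmetric function of a graph $G$ with vertices $v_1,\dots,v_n$ is $X_G=\sum_{\kappa}x_{\kappa(v_1)}\cdots x_{\kappa(v_n)}$, summed over all proper colorings $\kappa:V(G)\to\{1,2,3,\dots\}$; it is a homogeneous symmetric function of degree $n$ over $\mathbb{Q}$. Let $e_\lambda=e_{\lambda_1}e_{\lambda_2}\cdots$ be the elementary symmetric functions; $[e_\lambda]F$ denotes the coefficient of $e_\lambda$ in $F$ expanded in this basis, and $F$ is $e$-positive if $[e_\lambda]F\ge 0$ for all $\lambda$. For connected graphs $G,H$ on $n$ vertices (for which $[e_{(n)}]X_G$ and $[e_{(n)}]X_H$ are positive), set $$X_e(G,H)=X_G-\frac{[e_{(n)}]X_G}{[e_{(n)}]X_H}X_H.$$ $\mathcal{E}_n$ is the poset whose elements are the equivalence classes of connected graphs on $n$ vertices under $G\sim H\iff X_G=X_H$, ordered by $G\geq_e H$ if and only if $X_e(G,H)$ is $e$-positive. An element $x$ of a poset is maximal if $y\leq x$ for every $y$ comparable to $x$. -}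

module Defs where

import Algebra.Properties.CommutativeMonoid.Sum
open import Data.Bool using (Bool; true; false; T)
open import Data.Bool.Properties using (T?)
open import Data.Empty using (⊥-elim)
open import Data.Fin using (Fin; zero; suc; toℕ; inject₁; fromℕ)
open import Data.Fin.Permutation using (Permutation; _⟨$⟩ʳ_)
import Data.Fin.Permutation as Perm
import Data.Fin.Properties as Fin
open import Data.Integer using (+_)
open import Data.List using (List; []; _∷_; _++_; map; length; filter; lookup; foldr; replicate; allFin; tabulate; cartesianProductWith)
import Data.List.Properties as List
open import Data.List.Membership.Propositional using (_∈_)
open import Data.List.Membership.Propositional.Properties using (∈-map⁺; ∈-++⁺ˡ; ∈-++⁺ʳ; ∈-filter⁺; ∈-filter⁻)
open import Data.List.Relation.Binary.Permutation.Propositional using (_↭_; refl; prep; swap; trans; ↭-sym; ↭-trans; ↭-reflexive; ↭⇒↭ₛ)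
open import Data.List.Relation.Binary.Permutation.Propositional.Properties using (map⁺; ++⁺ʳ; shift; ↭-length; ++-comm)
open import Data.List.Relation.Unary.All using (All; []; _∷_)
import Data.List.Relation.Unary.All as All
import Data.List.Relation.Unary.All.Properties as Allₚ
open import Data.List.Relation.Unary.AllPairs using (AllPairs; []; _∷_)
import Data.List.Relation.Unary.AllPairs as AllPairs
import Data.List.Relation.Unary.AllPairs.Properties as AllPairsₚ
open import Data.List.Relation.Unary.Any using (here; there)
open import Data.List.Relation.Unary.Linked using (Linked; []; [-]; _∷_; linked?)
import Data.List.Relation.Unary.Linked as Linked
open import Data.Nat.ListAction using (sum)
import Data.Nat.ListAction.Properties as ListAction
open import Data.Nat as ℕ using (ℕ; zero; suc; _∸_; z≤n; s≤s; _≥?_)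
import Data.Nat.Properties as ℕ
open import Data.Product using (Σ; Σ-syntax; ∃; ∃-syntax; _×_; _,_; proj₁; proj₂)
open import Data.Rational using (ℚ; 0ℚ; 1ℚ; _+_; _*_; -_; _-_; _/_; _÷_; _≤_; _≟_; ≢-nonZero)
import Data.Rational.Properties as ℚ
open import Data.Sum using (_⊎_; inj₁; inj₂)
open import Data.Vec using (Vec; []; _∷_; count)
import Data.Vec as Vec
import Data.Vec.Properties as Vec
open import Function using (_∘_; flip; id; Injective)
open import Function.Bundles using (_⇔_; mk⇔)
open import Level using (0ℓ)
open import Relation.Binary using (Rel; Setoid; _Respects₂_; Decidable)
open import Relation.Binary.Construct.Closure.ReflexiveTransitive using (Star)
open import Relation.Binary.PropositionalEquality
  using (_≡_; _≢_; _≗_; refl; sym; cong; cong₂; subst; module ≡-Reasoning)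
  renaming (trans to ≡-trans)
open import Relation.Nullary using (¬_; Dec; yes; no; does)
open import Relation.Nullary.Decidable using (_×-dec_; _→-dec_; ¬?; does-⇔; dec-false)
open import Relation.Unary using (Pred)

module Σℕ = Algebra.Properties.CommutativeMonoid.Sum ℕ.+-0-commutativeMonoid
module Σℚ = Algebra.Properties.CommutativeMonoid.Sum ℚ.+-0-commutativeMonoid
open Σℚ using (sum⁺-syntax)

-- A formal power series over ℚ in x₁, x₂, … is given by its coefficients:
-- the list a₁ ∷ … ∷ aₘ ∷ [] stands for the monomial x₁^a₁ ⋯ xₘ^aₘ.  Lists
-- that differ by trailing zeros denote the same monomial; the fields
-- ↭-invariant and 0-stable below make the coefficients agree on them.
Series : Set
Series = List ℕ → ℚ

-- The Cauchy product, by recursion on the exponents.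
infixl 7 _⊛_
_⊛_ : Series → Series → Series
(f ⊛ g) []      = f [] * g []
(f ⊛ g) (a ∷ α) =
  ∑[ i ≤ a ] ((λ β → f (toℕ i ∷ β)) ⊛ (λ γ → g (a ∸ toℕ i ∷ γ))) α

-- Symmetric of degree d.  Under ↭-invariant, 0-stable says that appending
-- an unused variable does not change a coefficient.
record IsSymmetric (d : ℕ) (f : Series) : Set where
  field
    ↭-invariant : ∀ {α β} → α ↭ β → f α ≡ f β
    0-stable    : ∀ α → f (0 ∷ α) ≡ f α
    homogeneous : ∀ α → sum α ≢ d → f α ≡ 0ℚ

record SymmetricFunction (d : ℕ) : Set where
  constructor symmetric
  field
    coeff       : Series
    isSymmetric : IsSymmetric d coeff
  open IsSymmetric isSymmetric public

open SymmetricFunction using (coeff)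

infix 4 _≈_
_≈_ : ∀ {d} → Rel (SymmetricFunction d) 0ℓ
F ≈ K = coeff F ≗ coeff K

sub-scale-sym : ∀ {d f g} c → IsSymmetric d f → IsSymmetric d g →
                IsSymmetric d (λ α → f α - c * g α)
sub-scale-sym c F G = record
  { ↭-invariant = λ p → cong₂ (λ x y → x - c * y) (F.↭-invariant p) (G.↭-invariant p)
  ; 0-stable    = λ α → cong₂ (λ x y → x - c * y) (F.0-stable α) (G.0-stable α)
  ; homogeneous = λ α ne → ≡-trans
      (cong₂ (λ x y → x - c * y) (F.homogeneous α ne) (G.homogeneous α ne))
      (cong (λ z → 0ℚ - z) (ℚ.*-zeroʳ c))
  }
  where module F = IsSymmetric F
        module G = IsSymmetric G

-- F −[ c ] K  is  F − c K.
infixl 6 _−[_]_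
_−[_]_ : ∀ {d} → SymmetricFunction d → ℚ → SymmetricFunction d → SymmetricFunction d
symmetric f F −[ c ] symmetric g G = symmetric (λ α → f α - c * g α) (sub-scale-sym c F G)

-- The monomials of e k are the products of k distinct variables.
e : ℕ → Series
e zero    []                = 1ℚ
e (suc k) []                = 0ℚ
e zero    (zero ∷ α)        = e zero α
e zero    (suc _ ∷ α)       = 0ℚ
e (suc k) (zero ∷ α)        = e (suc k) α
e (suc k) (suc zero ∷ α)    = e k α
e (suc k) (suc (suc _) ∷ α) = 0ℚ

-- e 0 is the constant series 1.
eProduct : List ℕ → Series
eProduct = foldr (λ k f → e k ⊛ f) (e 0)

infix 4 _⊢_
record _⊢_ (ν : List ℕ) (n : ℕ) : Set where
  field
    parts-positive   : All (0 ℕ.<_) ν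
    parts-decreasing : Linked ℕ._≥_ ν
    parts-sum        : sum ν ≡ n

incHead : List ℕ → List ℕ
incHead []      = []
incHead (k ∷ κ) = suc k ∷ κ

compositions : ℕ → List (List ℕ)
compositions zero          = [] ∷ []
compositions (suc zero)    = (1 ∷ []) ∷ []
compositions (suc (suc n)) =
  map (1 ∷_) (compositions (suc n)) ++ map incHead (compositions (suc n))

-- All partitions of n, in increasing lexicographic order.
partitions : ℕ → List (List ℕ)
partitions n = filter (linked? _≥?_) (compositions n)

∑∈ : ∀ {A : Set} → List A → (A → ℚ) → ℚ
∑∈ []       f = 0ℚ
∑∈ (x ∷ xs) f = f x + ∑∈ xs f

record eExpansion {n} (F : SymmetricFunction n) : Set where
  field
    coefficient : List ℕ → ℚ
    expands     : ∀ α → coeff F α ≡ ∑∈ (partitions n) (λ ν → coefficient ν * eProduct ν α)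

private
  incHead-sum : ∀ {κ n} → sum κ ≡ suc n → sum (incHead κ) ≡ suc (suc n)
  incHead-sum {k ∷ κ} eq = cong suc eq

  compositions-sound : ∀ n → All (λ κ → All (0 ℕ.<_) κ × sum κ ≡ n) (compositions n)
  compositions-sound zero          = ([] , refl) ∷ []
  compositions-sound (suc zero)    = (s≤s z≤n ∷ [] , refl) ∷ []
  compositions-sound (suc (suc n)) = Allₚ.++⁺
    (Allₚ.map⁺ (All.map (λ (p , q) → s≤s z≤n ∷ p , cong suc q) (compositions-sound (suc n))))
    (Allₚ.map⁺ (All.map (λ {κ} (p , q) → inc p , incHead-sum {κ} q) (compositions-sound (suc n))))
    where
    inc : ∀ {κ} → All (0 ℕ.<_) κ → All (0 ℕ.<_) (incHead κ)
    inc []      = []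
    inc (_ ∷ p) = s≤s z≤n ∷ p

  compositions-complete : ∀ n κ → All (0 ℕ.<_) κ → sum κ ≡ n → κ ∈ compositions n
  compositions-complete zero    []          p eq = here refl
  compositions-complete zero    (suc _ ∷ κ) p ()
  compositions-complete _       (zero ∷ κ) (() ∷ _) eq
  compositions-complete (suc zero) (suc zero ∷ []) p eq = here refl
  compositions-complete (suc zero) (suc zero ∷ suc _ ∷ κ) p ()
  compositions-complete (suc zero) (suc zero ∷ zero ∷ κ) (_ ∷ () ∷ _) eq
  compositions-complete (suc zero) (suc (suc _) ∷ κ) p ()
  compositions-complete (suc (suc n)) (suc zero ∷ κ) (_ ∷ p) eq =
    ∈-++⁺ˡ (∈-map⁺ (1 ∷_) (compositions-complete (suc n) κ p (ℕ.suc-injective eq)))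
  compositions-complete (suc (suc n)) (suc (suc k) ∷ κ) (_ ∷ p) eq =
    ∈-++⁺ʳ (map (1 ∷_) (compositions (suc n)))
      (∈-map⁺ incHead (compositions-complete (suc n) (suc k ∷ κ) (s≤s z≤n ∷ p) (ℕ.suc-injective eq)))

∈-partitions : ∀ {n ν} → (ν ∈ partitions n) ⇔ (ν ⊢ n)
∈-partitions {n} {ν} = mk⇔ to from
  where
  to : ν ∈ partitions n → ν ⊢ n
  to i with ∈-filter⁻ (linked? _≥?_) {xs = compositions n} i
  ... | j , dec with All.lookup (compositions-sound n) j
  ... | pos , eq = record { parts-positive = pos ; parts-decreasing = dec ; parts-sum = eq }
  from : ν ⊢ n → ν ∈ partitions n
  from p = ∈-filter⁺ (linked? _≥?_)
    (compositions-complete n ν (_⊢_.parts-positive p) (_⊢_.parts-sum p)) (_⊢_.parts-decreasing p)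

private
  ∈⇒⊢ : ∀ {n ν} → ν ∈ partitions n → ν ⊢ n
  ∈⇒⊢ = Function.Bundles.Equivalence.to ∈-partitions

  ⊢⇒∈ : ∀ {n ν} → ν ⊢ n → ν ∈ partitions n
  ⊢⇒∈ = Function.Bundles.Equivalence.from ∈-partitions

  infix 4 _≺_
  data _≺_ : Rel (List ℕ) 0ℓ where
    here  : ∀ {k l κ ν} → k ℕ.< l → k ∷ κ ≺ l ∷ ν
    there : ∀ {k κ ν} → κ ≺ ν → k ∷ κ ≺ k ∷ ν

  ≺-irrefl : ∀ {κ} → ¬ (κ ≺ κ)
  ≺-irrefl (here p)  = ℕ.<-irrefl refl p
  ≺-irrefl (there p) = ≺-irrefl p

  incHead-≺ : ∀ {κ ν} → κ ≺ ν → incHead κ ≺ incHead ν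
  incHead-≺ (here p)  = here (s≤s p)
  incHead-≺ (there p) = there p

  compositions-≺ : ∀ n → AllPairs _≺_ (compositions n)
  compositions-≺ zero          = [] ∷ []
  compositions-≺ (suc zero)    = [] ∷ []
  compositions-≺ (suc (suc n)) = AllPairsₚ.++⁺
    (AllPairsₚ.map⁺ (AllPairs.map there (compositions-≺ (suc n))))
    (AllPairsₚ.map⁺ (AllPairs.map incHead-≺ (compositions-≺ (suc n))))
    (Allₚ.map⁺ (All.universal (λ _ → Allₚ.map⁺ (All.map (λ (p , q) → below p q) (compositions-sound (suc n))))
                              (compositions (suc n))))
    where
    below : ∀ {κ ν} → All (0 ℕ.<_) ν → sum ν ≡ suc n → 1 ∷ κ ≺ incHead ν
    below (p ∷ _) _ = here (s≤s p)

  partitions-≺ : ∀ n → AllPairs _≺_ (partitions n)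
  partitions-≺ n = AllPairsₚ.filter⁺ (linked? _≥?_) (compositions-≺ n)

  partitions-decreasing : ∀ n → All (Linked ℕ._≥_) (partitions n)
  partitions-decreasing n = Allₚ.all-filter (linked? _≥?_) (compositions n)

∑-zero : ∀ {n} (t : Fin n → ℚ) → (∀ i → t i ≡ 0ℚ) → Σℚ.sum t ≡ 0ℚ
∑-zero {n} t h = ≡-trans (Σℚ.sum-cong-≗ h) (Σℚ.sum-replicate-zero n)

⊛-cong : ∀ {f f′ g g′} → f ≗ f′ → g ≗ g′ → f ⊛ g ≗ f′ ⊛ g′
⊛-cong p q []      = cong₂ _*_ (p []) (q [])
⊛-cong p q (a ∷ α) = Σℚ.sum-cong-≗ {suc a} λ i →
  ⊛-cong (λ β → p (toℕ i ∷ β)) (λ γ → q (a ∸ toℕ i ∷ γ)) α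

⊛-zeroˡ : ∀ {f} g → f ≗ (λ _ → 0ℚ) → f ⊛ g ≗ (λ _ → 0ℚ)
⊛-zeroˡ g p []      = ≡-trans (cong (_* g []) (p [])) (ℚ.*-zeroˡ (g []))
⊛-zeroˡ g p (a ∷ α) = ∑-zero {suc a} _ λ i →
  ⊛-zeroˡ (λ γ → g (a ∸ toℕ i ∷ γ)) (λ β → p (toℕ i ∷ β)) α

⊛-↭ : ∀ {f g} → (∀ {α β} → α ↭ β → f α ≡ f β) → (∀ {α β} → α ↭ β → g α ≡ g β) →
      ∀ {α β} → α ↭ β → (f ⊛ g) α ≡ (f ⊛ g) β
⊛-↭ F G refl        = refl
⊛-↭ F G (prep x p)  = Σℚ.sum-cong-≗ {suc x} λ i →
  ⊛-↭ (λ q → F (prep (toℕ i) q)) (λ q → G (prep (x ∸ toℕ i) q)) p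
⊛-↭ {f} {g} F G {_ ∷ _ ∷ α} {_ ∷ _ ∷ β} (swap x y p) = ≡-trans
  (Σℚ.∑-comm {suc x} {suc y} λ i j →
    ((λ γ → f (toℕ i ∷ toℕ j ∷ γ)) ⊛ (λ γ → g (x ∸ toℕ i ∷ y ∸ toℕ j ∷ γ))) α)
  (Σℚ.sum-cong-≗ {suc y} λ j → Σℚ.sum-cong-≗ {suc x} λ i → ≡-trans
    (⊛-↭ (λ q → F (prep (toℕ i) (prep (toℕ j) q)))
          (λ q → G (prep (x ∸ toℕ i) (prep (y ∸ toℕ j) q))) p)
    (⊛-cong (λ γ → F (swap (toℕ i) (toℕ j) refl)) (λ γ → G (swap (x ∸ toℕ i) (y ∸ toℕ j) refl)) β))
⊛-↭ F G (trans p q) = ≡-trans (⊛-↭ F G p) (⊛-↭ F G q)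

shuffle : ∀ s t i j x → (s ℕ.+ i) ℕ.+ (t ℕ.+ j) ℕ.+ x ≡ s ℕ.+ t ℕ.+ ((i ℕ.+ j) ℕ.+ x)
shuffle = solve-∀
  where open import Data.Nat.Tactic.RingSolver using (solve-∀)

⊛-homogeneous : ∀ {m n} s t {f g} →
  (∀ α → s ℕ.+ sum α ≢ m → f α ≡ 0ℚ) → (∀ α → t ℕ.+ sum α ≢ n → g α ≡ 0ℚ) →
  ∀ α → s ℕ.+ t ℕ.+ sum α ≢ m ℕ.+ n → (f ⊛ g) α ≡ 0ℚ
⊛-homogeneous {m} {n} s t {f} {g} F G [] ne with s ℕ.+ 0 ℕ.≟ m
... | no s≢m = ≡-trans (cong (_* g []) (F [] s≢m)) (ℚ.*-zeroˡ (g []))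
... | yes refl = ≡-trans (cong (f [] *_) (G [] λ { refl → ne (lemma s t) })) (ℚ.*-zeroʳ (f []))
  where
  open import Data.Nat.Tactic.RingSolver using (solve-∀)
  lemma : ∀ s t → s ℕ.+ t ℕ.+ 0 ≡ s ℕ.+ 0 ℕ.+ (t ℕ.+ 0)
  lemma = solve-∀
⊛-homogeneous s t F G (a ∷ α) ne = ∑-zero {suc a} _ λ i →
  ⊛-homogeneous (s ℕ.+ toℕ i) (t ℕ.+ (a ∸ toℕ i))
    (λ β h → F (toℕ i ∷ β) (h ∘ ≡-trans (ℕ.+-assoc s (toℕ i) (sum β))))
    (λ γ h → G (a ∸ toℕ i ∷ γ) (h ∘ ≡-trans (ℕ.+-assoc t (a ∸ toℕ i) (sum γ))))
    α
    (λ h → ne (≡-trans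
      (sym (≡-trans (shuffle s t (toℕ i) (a ∸ toℕ i) (sum α))
        (cong (λ z → s ℕ.+ t ℕ.+ (z ℕ.+ sum α)) (ℕ.m+[n∸m]≡n (ℕ.≤-pred (Fin.toℕ<n i))))))
      h))

⊛-sym : ∀ {m n f g} → IsSymmetric m f → IsSymmetric n g → IsSymmetric (m ℕ.+ n) (f ⊛ g)
⊛-sym F G = record
  { ↭-invariant = ⊛-↭ F.↭-invariant G.↭-invariant
  ; 0-stable    = λ α → ≡-trans (ℚ.+-identityʳ _) (⊛-cong F.0-stable G.0-stable α)
  ; homogeneous = ⊛-homogeneous 0 0 F.homogeneous G.homogeneous
  }
  where module F = IsSymmetric F
        module G = IsSymmetric G

e-zero : ∀ k α → e k (0 ∷ α) ≡ e k α
e-zero zero    α = refl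
e-zero (suc k) α = refl

e-prep : ∀ k x {α β} → (∀ k → e k α ≡ e k β) → e k (x ∷ α) ≡ e k (x ∷ β)
e-prep zero    zero          h = h 0
e-prep zero    (suc x)       h = refl
e-prep (suc k) zero          h = h (suc k)
e-prep (suc k) (suc zero)    h = h k
e-prep (suc k) (suc (suc x)) h = refl

e-swap : ∀ k x y α → e k (x ∷ y ∷ α) ≡ e k (y ∷ x ∷ α)
e-swap zero zero zero α = refl
e-swap zero zero (suc y) α = refl
e-swap zero (suc x) zero α = refl
e-swap zero (suc x) (suc y) α = refl
e-swap (suc k) zero zero α = refl
e-swap (suc k) zero (suc zero) α = sym (e-zero k α)
e-swap (suc k) zero (suc (suc y)) α = refl
e-swap (suc k) (suc zero) zero α = e-zero k α
e-swap (suc k) (suc zero) (suc zero) α = refl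
e-swap (suc zero) (suc zero) (suc (suc y)) α = refl
e-swap (suc (suc k)) (suc zero) (suc (suc y)) α = refl
e-swap (suc k) (suc (suc x)) zero α = refl
e-swap (suc zero) (suc (suc x)) (suc zero) α = refl
e-swap (suc (suc k)) (suc (suc x)) (suc zero) α = refl
e-swap (suc k) (suc (suc x)) (suc (suc y)) α = refl

e-↭ : ∀ {α β} → α ↭ β → ∀ k → e k α ≡ e k β
e-↭ refl         k = refl
e-↭ (prep x p)   k = e-prep k x (e-↭ p)
e-↭ {_ ∷ _ ∷ α} (swap x y p) k =
  ≡-trans (e-swap k x y α) (e-prep k y λ l → e-prep l x (e-↭ p))
e-↭ (trans p q)  k = ≡-trans (e-↭ p k) (e-↭ q k)

e-homogeneous : ∀ k α → sum α ≢ k → e k α ≡ 0ℚ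
e-homogeneous zero    []                ne = ⊥-elim (ne refl)
e-homogeneous (suc k) []                ne = refl
e-homogeneous zero    (zero ∷ α)        ne = e-homogeneous zero α ne
e-homogeneous zero    (suc x ∷ α)       ne = refl
e-homogeneous (suc k) (zero ∷ α)        ne = e-homogeneous (suc k) α ne
e-homogeneous (suc k) (suc zero ∷ α)    ne = e-homogeneous k α (ne ∘ cong suc)
e-homogeneous (suc k) (suc (suc x) ∷ α) ne = refl

e-sym : ∀ k → IsSymmetric k (e k)
e-sym k = record
  { ↭-invariant = λ p → e-↭ p k
  ; 0-stable    = e-zero k
  ; homogeneous = e-homogeneous k
  }

eProduct-sym : ∀ ν → IsSymmetric (sum ν) (eProduct ν)
eProduct-sym []      = e-sym 0
eProduct-sym (k ∷ ν) = ⊛-sym (e-sym k) (eProduct-sym ν)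

private
  pad : ℕ → List ℕ → List ℕ
  pad zero    α       = []
  pad (suc k) []      = 0 ∷ pad k []
  pad (suc k) (a ∷ α) = a ∷ pad k α

  -- The conjugate partition: the exponents of the leading monomial of
  -- eProduct κ.
  conj : List ℕ → List ℕ
  conj []      = []
  conj (k ∷ κ) = map suc (pad k (conj κ))

  pad-length : ∀ k α → length (pad k α) ≡ k
  pad-length zero    α       = refl
  pad-length (suc k) []      = cong suc (pad-length k [])
  pad-length (suc k) (a ∷ α) = cong suc (pad-length k α)

  pad-[] : ∀ z → pad z [] ≡ replicate z 0
  pad-[] zero    = refl
  pad-[] (suc z) = cong (0 ∷_) (pad-[] z)

  pad-++ : ∀ α z → pad (length α ℕ.+ z) α ≡ α ++ replicate z 0
  pad-++ []      z = pad-[] z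
  pad-++ (a ∷ α) z = cong (a ∷_) (pad-++ α z)

  conj-length : ∀ k κ → length (conj (k ∷ κ)) ≡ k
  conj-length k κ = ≡-trans (List.length-map ℕ.suc (pad k (conj κ))) (pad-length k (conj κ))

  zeros-invariant : ∀ {d f} → IsSymmetric d f → ∀ α z → f (α ++ replicate z 0) ≡ f α
  zeros-invariant {f = f} S α zero = cong f (List.++-identityʳ α)
  zeros-invariant S α (suc z) =
    ≡-trans (IsSymmetric.↭-invariant S (shift 0 α (replicate z 0)))
      (≡-trans (IsSymmetric.0-stable S _) (zeros-invariant S α z))

  pad-invariant : ∀ {d f} → IsSymmetric d f → ∀ k α → length α ℕ.≤ k → f (pad k α) ≡ f α
  pad-invariant {f = f} S k α le = ≡-trans
    (cong f (≡-trans (cong (λ l → pad l α) (sym (ℕ.m+[n∸m]≡n le))) (pad-++ α (k ∸ length α))))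
    (zeros-invariant S α (k ∸ length α))

  e-excess : ∀ k α g → length α ℕ.< k → (e k ⊛ g) α ≡ 0ℚ
  e-excess (suc k) []      g lt = ℚ.*-zeroˡ (g [])
  e-excess (suc k) (a ∷ α) g (s≤s lt) = ∑-zero {suc a} _ λ i →
    term (toℕ i) (λ γ → g (a ∸ toℕ i ∷ γ))
    where
    term : ∀ i g → ((λ β → e (suc k) (i ∷ β)) ⊛ g) α ≡ 0ℚ
    term zero          g = e-excess (suc k) α g (ℕ.m≤n⇒m≤1+n lt)
    term (suc zero)    g = e-excess k α g lt
    term (suc (suc i)) g = ⊛-zeroˡ g (λ _ → refl) α

  e-full : ∀ β g → (e (length β) ⊛ g) (map suc β) ≡ g β
  e-full []      g = ℚ.*-identityˡ (g [])
  e-full (b ∷ β) g = ≡-trans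
    (cong₂ _+_
      (e-excess (suc (length β)) (map suc β) _ (s≤s (ℕ.≤-reflexive (List.length-map suc β))))
      (cong₂ _+_ (e-full β (λ γ → g (b ∷ γ)))
        (∑-zero {b} _ λ i → ⊛-zeroˡ (λ γ → g (suc b ∸ suc (suc (toℕ i)) ∷ γ)) (λ _ → refl) (map suc β))))
    (≡-trans (ℚ.+-identityˡ _) (ℚ.+-identityʳ _))

  e-full-pad : ∀ k α g → (e k ⊛ g) (map suc (pad k α)) ≡ g (pad k α)
  e-full-pad k α g = subst (λ l → (e l ⊛ g) (map suc (pad k α)) ≡ g (pad k α))
    (pad-length k α) (e-full (pad k α) g)

  conj-bound : ∀ {k κ} → Linked ℕ._≥_ (k ∷ κ) → length (conj κ) ℕ.≤ k
  conj-bound [-]               = z≤n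
  conj-bound {κ = l ∷ κ} (p ∷ _) = subst (ℕ._≤ _) (sym (conj-length l κ)) p

  strip : ∀ {k κ} ν → Linked ℕ._≥_ (k ∷ κ) →
          eProduct (k ∷ ν) (conj (k ∷ κ)) ≡ eProduct ν (conj κ)
  strip {k} {κ} ν dec = ≡-trans (e-full-pad k (conj κ) (eProduct ν))
    (pad-invariant (eProduct-sym ν) k (conj κ) (conj-bound dec))

  diagonal : ∀ {κ} → Linked ℕ._≥_ κ → eProduct κ (conj κ) ≡ 1ℚ
  diagonal {[]}    dec = refl
  diagonal {k ∷ κ} dec = ≡-trans (strip κ dec) (diagonal (Linked.tail dec))

  triangular : ∀ {κ ν} → Linked ℕ._≥_ κ → κ ≺ ν → eProduct ν (conj κ) ≡ 0ℚ
  triangular {k ∷ κ} {l ∷ ν} dec (here p) =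
    e-excess l (conj (k ∷ κ)) (eProduct ν) (subst (ℕ._< l) (sym (conj-length k κ)) p)
  triangular {k ∷ κ} {_ ∷ ν} dec (there p) =
    ≡-trans (strip ν dec) (triangular (Linked.tail dec) p)

  -- Up to order and zeros, every exponent list is the conjugate of a partition.
  split-zeros : ∀ α → ∃[ β ] ∃[ z ] α ↭ map suc β ++ replicate z 0
  split-zeros [] = [] , 0 , refl
  split-zeros (zero ∷ α) with split-zeros α
  ... | β , z , p = β , suc z , ↭-trans (prep 0 p) (↭-sym (shift 0 (map suc β) (replicate z 0)))
  split-zeros (suc a ∷ α) with split-zeros α
  ... | β , z , p = a ∷ β , z , prep (suc a) p

  sum-↭ : ∀ {α β} → α ↭ β → sum α ≡ sum β
  sum-↭ = ListAction.sum-↭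

  sum-zeros : ∀ α z → sum (α ++ replicate z 0) ≡ sum α
  sum-zeros []      zero    = refl
  sum-zeros []      (suc z) = sum-zeros [] z
  sum-zeros (a ∷ α) z       = cong (a ℕ.+_) (sum-zeros α z)

  sum-map-suc : ∀ β → sum (map suc β) ≡ length β ℕ.+ sum β
  sum-map-suc []      = refl
  sum-map-suc (b ∷ β) = cong suc (≡-trans (cong (b ℕ.+_) (sum-map-suc β)) (swap+ b (length β) (sum β)))
    where
    open import Data.Nat.Tactic.RingSolver using (solve-∀)
    swap+ : ∀ x y z → x ℕ.+ (y ℕ.+ z) ≡ y ℕ.+ (x ℕ.+ z)
    swap+ = solve-∀

  ConjugateOf : List ℕ → Set
  ConjugateOf α = ∃[ κ ] (κ ⊢ sum α) × ∃[ z ] α ↭ conj κ ++ replicate z 0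

  sort-step : ∀ {α} β z → α ↭ map suc β ++ replicate z 0 →
              (0 ℕ.< length β → ConjugateOf β) → ConjugateOf α
  sort-step {α} [] z p _ = [] , record
    { parts-positive = [] ; parts-decreasing = []
    ; parts-sum = sym (≡-trans (sum-↭ p) (sum-zeros [] z)) } , z , p
  sort-step {α} β@(_ ∷ _) z p rec with rec (s≤s z≤n)
  ... | κ , κ⊢ , y , q = length β ∷ κ , record
      { parts-positive   = s≤s z≤n ∷ _⊢_.parts-positive κ⊢
      ; parts-decreasing = dec (subst (length (conj κ) ℕ.≤_) (sym lenβ) (ℕ.m≤m+n _ y)) (_⊢_.parts-decreasing κ⊢)
      ; parts-sum = ≡-trans (cong (length β ℕ.+_) (_⊢_.parts-sum κ⊢))
          (sym (≡-trans (sum-↭ p) (≡-trans (sum-zeros (map suc β) z) (sum-map-suc β))))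
      } , z , ↭-trans p (++⁺ʳ (replicate z 0) (map⁺ suc (↭-trans q (↭-reflexive
          (sym (≡-trans (cong (λ l → pad l (conj κ)) lenβ) (pad-++ (conj κ) y)))))))
    where
    lenβ : length β ≡ length (conj κ) ℕ.+ y
    lenβ = ≡-trans (↭-length q) (≡-trans (List.length-++ (conj κ))
      (cong (length (conj κ) ℕ.+_) (List.length-replicate y)))
    dec : ∀ {k κ} → length (conj κ) ℕ.≤ k → Linked ℕ._≥_ κ → Linked ℕ._≥_ (k ∷ κ)
    dec {κ = []}    le l = [-]
    dec {κ = j ∷ κ} le l = subst (ℕ._≤ _) (conj-length j κ) le ∷ l

  sort : ∀ fuel α → sum α ℕ.≤ fuel → ConjugateOf α
  sort fuel α le with split-zeros α
  ... | β , z , p = sort-step β z p (rec fuel (subst (ℕ._≤ fuel) sumα le))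
    where
    sumα : sum α ≡ length β ℕ.+ sum β
    sumα = ≡-trans (sum-↭ p) (≡-trans (sum-zeros (map suc β) z) (sum-map-suc β))
    rec : ∀ fuel → length β ℕ.+ sum β ℕ.≤ fuel → 0 ℕ.< length β → ConjugateOf β
    rec zero       le′ pos = ⊥-elim (ℕ.<⇒≱ pos (ℕ.m+n≤o⇒m≤o (length β) le′))
    rec (suc fuel) le′ pos = sort fuel β
      (ℕ.≤-pred (ℕ.≤-trans (ℕ.+-monoˡ-≤ (sum β) pos) le′))

  vanishing : ∀ {n f} → IsSymmetric n f → (∀ {κ} → κ ⊢ n → f (conj κ) ≡ 0ℚ) → ∀ α → f α ≡ 0ℚ
  vanishing {n} {f} S h α with sum α ℕ.≟ n
  ... | no  ne   = IsSymmetric.homogeneous S α ne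
  ... | yes refl with sort (sum α) α ℕ.≤-refl
  ... | κ , κ⊢ , z , p = ≡-trans (IsSymmetric.↭-invariant S p)
    (≡-trans (zeros-invariant S (conj κ) z) (h κ⊢))

  _≟ₗ_ : Decidable {A = List ℕ} _≡_
  _≟ₗ_ = List.≡-dec ℕ._≟_

  reduce : List ℕ → Series → Series
  reduce κ f α = f α - f (conj κ) * eProduct κ α

  -- By triangularity and diagonal, the coefficient of the lexicographically
  -- least κ is f (conj κ); subtract that term and continue.
  solve : List (List ℕ) → Series → List ℕ → ℚ
  solve []      f ν = 0ℚ
  solve (κ ∷ L) f ν with ν ≟ₗ κ
  ... | yes _ = f (conj κ)
  ... | no  _ = solve L (reduce κ f) ν

  solve-head : ∀ κ L f → solve (κ ∷ L) f κ ≡ f (conj κ)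
  solve-head κ L f with κ ≟ₗ κ
  ... | yes _ = refl
  ... | no ne = ⊥-elim (ne refl)

  solve-tail : ∀ {κ L ν} f → κ ≢ ν → solve (κ ∷ L) f ν ≡ solve L (reduce κ f) ν
  solve-tail {κ} {L} {ν} f ne with ν ≟ₗ κ
  ... | yes refl = ⊥-elim (ne refl)
  ... | no _     = refl

  solve-cong : ∀ L {f g} → f ≗ g → ∀ ν → solve L f ν ≡ solve L g ν
  solve-cong []      h ν = refl
  solve-cong (κ ∷ L) h ν with ν ≟ₗ κ
  ... | yes _ = h (conj κ)
  ... | no  _ = solve-cong L (λ α → cong₂ (λ x y → x - y * eProduct κ α) (h α) (h (conj κ))) ν

  combination : List (List ℕ) → (List ℕ → ℚ) → Series
  combination L c α = ∑∈ L (λ ν → c ν * eProduct ν α)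

  ∑∈-cong : ∀ {A : Set} (L : List A) {f g : A → ℚ} → All (λ x → f x ≡ g x) L → ∑∈ L f ≡ ∑∈ L g
  ∑∈-cong []      []       = refl
  ∑∈-cong (x ∷ L) (p ∷ ps) = cong₂ _+_ p (∑∈-cong L ps)

  ∑∈-zero : ∀ {A : Set} (L : List A) {f : A → ℚ} → All (λ x → f x ≡ 0ℚ) L → ∑∈ L f ≡ 0ℚ
  ∑∈-zero []      []       = refl
  ∑∈-zero (x ∷ L) (p ∷ ps) = ≡-trans (cong₂ _+_ p (∑∈-zero L ps)) (ℚ.+-identityˡ 0ℚ)

  remainder : List (List ℕ) → Series → Series
  remainder []      f = f
  remainder (κ ∷ L) f = remainder L (reduce κ f)

  cancel : ∀ x y → x ≡ y + (x - y)
  cancel x y = sym (begin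
    y + (x - y)   ≡⟨ ℚ.+-comm y (x - y) ⟩
    x - y + y     ≡⟨ ℚ.+-assoc x (- y) y ⟩
    x + (- y + y) ≡⟨ cong (_+_ x) (ℚ.+-inverseˡ y) ⟩
    x + 0ℚ        ≡⟨ ℚ.+-identityʳ x ⟩
    x             ∎)
    where open ≡-Reasoning

  solve-remainder : ∀ L f → AllPairs _≺_ L → ∀ α →
    f α ≡ combination L (solve L f) α + remainder L f α
  solve-remainder []      f []       α = sym (ℚ.+-identityˡ (f α))
  solve-remainder (κ ∷ L) f (p ∷ ps) α = begin
    f α
      ≡⟨ cancel (f α) (f (conj κ) * eProduct κ α) ⟩
    f (conj κ) * eProduct κ α + reduce κ f α
      ≡⟨ cong₂ _+_ (cong (_* eProduct κ α) (sym (solve-head κ L f)))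
           (solve-remainder L (reduce κ f) ps α) ⟩
    solve (κ ∷ L) f κ * eProduct κ α + (combination L (solve L (reduce κ f)) α + remainder L (reduce κ f) α)
      ≡⟨ ℚ.+-assoc (solve (κ ∷ L) f κ * eProduct κ α) _ _ ⟨
    solve (κ ∷ L) f κ * eProduct κ α + combination L (solve L (reduce κ f)) α + remainder L (reduce κ f) α
      ≡⟨ cong (λ z → solve (κ ∷ L) f κ * eProduct κ α + z + remainder L (reduce κ f) α)
           (∑∈-cong L (All.map (λ {ν} q → cong (_* eProduct ν α)
             (sym (solve-tail {L = L} f λ { refl → ≺-irrefl q }))) p)) ⟩
    combination (κ ∷ L) (solve (κ ∷ L) f) α + remainder (κ ∷ L) f α
      ∎
    where open ≡-Reasoning

  minus-zero : ∀ x y {z} → z ≡ 0ℚ → x - y * z ≡ x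
  minus-zero x y refl = ≡-trans (cong (λ z → x - z) (ℚ.*-zeroʳ y)) (ℚ.+-identityʳ x)

  remainder-below : ∀ {κ} L f → Linked ℕ._≥_ κ → All (κ ≺_) L →
    remainder L f (conj κ) ≡ f (conj κ)
  remainder-below []      f dec []       = refl
  remainder-below {κ} (ν ∷ L) f dec (p ∷ ps) = ≡-trans
    (remainder-below L (reduce ν f) dec ps)
    (minus-zero (f (conj κ)) (f (conj ν)) (triangular dec p))

  remainder-vanishes : ∀ L f → AllPairs _≺_ L → All (Linked ℕ._≥_) L →
    ∀ {κ} → κ ∈ L → remainder L f (conj κ) ≡ 0ℚ
  remainder-vanishes (κ ∷ L) f (p ∷ ps) (d ∷ ds) (here refl) = ≡-trans
    (remainder-below L (reduce κ f) d p)
    (≡-trans (cong (λ z → f (conj κ) - f (conj κ) * z) (diagonal d))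
      (≡-trans (cong (λ z → f (conj κ) - z) (ℚ.*-identityʳ (f (conj κ)))) (ℚ.+-inverseʳ (f (conj κ)))))
  remainder-vanishes (κ ∷ L) f (p ∷ ps) (d ∷ ds) (there i) =
    remainder-vanishes L (reduce κ f) ps ds i

  remainder-sym : ∀ {n} L {f} → All (λ κ → sum κ ≡ n) L → IsSymmetric n f → IsSymmetric n (remainder L f)
  remainder-sym []      []          S = S
  remainder-sym (κ ∷ L) {f} (refl ∷ ps) S =
    remainder-sym L ps (sub-scale-sym (f (conj κ)) S (eProduct-sym κ))

  solve-combination : ∀ L c → AllPairs _≺_ L → All (Linked ℕ._≥_) L →
    ∀ {ν} → ν ∈ L → solve L (combination L c) ν ≡ c ν
  solve-combination (κ ∷ L) c (p ∷ ps) (d ∷ ds) {ν} i = go i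
    where
    open ≡-Reasoning
    f = combination (κ ∷ L) c
    lead : f (conj κ) ≡ c κ
    lead = ≡-trans (cong₂ _+_
        (≡-trans (cong (c κ *_) (diagonal d)) (ℚ.*-identityʳ (c κ)))
        (∑∈-zero L (All.map (λ {ν} q → ≡-trans (cong (c ν *_) (triangular d q)) (ℚ.*-zeroʳ (c ν))) p)))
      (ℚ.+-identityʳ (c κ))
    rest : reduce κ f ≗ combination L c
    rest α = begin
      f α - f (conj κ) * eProduct κ α                         ≡⟨ cong (λ z → f α - z * eProduct κ α) lead ⟩
      c κ * eProduct κ α + combination L c α - c κ * eProduct κ α
        ≡⟨ cong (_- c κ * eProduct κ α) (ℚ.+-comm (c κ * eProduct κ α) (combination L c α)) ⟩
      combination L c α + c κ * eProduct κ α - c κ * eProduct κ α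
        ≡⟨ ℚ.+-assoc (combination L c α) _ _ ⟩
      combination L c α + (c κ * eProduct κ α - c κ * eProduct κ α)
        ≡⟨ cong (_+_ (combination L c α)) (ℚ.+-inverseʳ (c κ * eProduct κ α)) ⟩
      combination L c α + 0ℚ                                  ≡⟨ ℚ.+-identityʳ _ ⟩
      combination L c α                                       ∎
    go : ∀ {ν} → ν ∈ κ ∷ L → solve (κ ∷ L) f ν ≡ c ν
    go (here refl) = ≡-trans (solve-head κ L f) lead
    go {ν} (there i) = begin
      solve (κ ∷ L) f ν          ≡⟨ solve-tail {L = L} f (λ { refl → ≺-irrefl (All.lookup p i) }) ⟩
      solve L (reduce κ f) ν     ≡⟨ solve-cong L rest ν ⟩
      solve L (combination L c) ν ≡⟨ solve-combination L c ps ds i ⟩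
      c ν                        ∎

eExpand : ∀ {n} (F : SymmetricFunction n) → eExpansion F
eExpand {n} (symmetric f S) = record
  { coefficient = solve (partitions n) f
  ; expands     = λ α → ≡-trans (solve-remainder (partitions n) f (partitions-≺ n) α)
      (≡-trans (cong (_+_ (combination (partitions n) (solve (partitions n) f) α)) (zero-remainder α))
        (ℚ.+-identityʳ _))
  }
  where
  zero-remainder : ∀ α → remainder (partitions n) f α ≡ 0ℚ
  zero-remainder = vanishing
    (remainder-sym (partitions n) (All.tabulate (_⊢_.parts-sum ∘ ∈⇒⊢)) S)
    (λ κ⊢ → remainder-vanishes (partitions n) f (partitions-≺ n) (partitions-decreasing n) (⊢⇒∈ κ⊢))

-- [e ν ] F is meaningful for ν ⊢ n.
infix 8 [e_]_
[e_]_ : ∀ {n} → List ℕ → SymmetricFunction n → ℚ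
[e ν ] F = eExpansion.coefficient (eExpand F) ν

eExpansion-unique : ∀ {n} (F : SymmetricFunction n) (E : eExpansion F) →
                    ∀ {ν} → ν ⊢ n → eExpansion.coefficient E ν ≡ [e ν ] F
eExpansion-unique {n} F E {ν} ν⊢ = ≡-trans
  (sym (solve-combination (partitions n) (eExpansion.coefficient E)
    (partitions-≺ n) (partitions-decreasing n) (⊢⇒∈ ν⊢)))
  (solve-cong (partitions n) (λ α → sym (eExpansion.expands E α)) ν)

[e]-cong : ∀ {n} {F K : SymmetricFunction n} → F ≈ K → ∀ ν → [e ν ] F ≡ [e ν ] K
[e]-cong {n} h ν = solve-cong (partitions n) h ν

ePositive : ∀ {n} → SymmetricFunction n → Set
ePositive {n} F = ∀ ν → ν ⊢ n → 0ℚ ≤ [e ν ] F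

record Graph (n : ℕ) : Set where
  field
    adjacent       : Fin n → Fin n → Bool
    adjacent-sym   : ∀ u v → adjacent u v ≡ adjacent v u
    adjacent-irrefl : ∀ v → adjacent v v ≡ false

  Adjacent : Rel (Fin n) 0ℓ
  Adjacent u v = T (adjacent u v)

module _ {n} (G : Graph n) where
  open Graph G

  -- Connected graphs are nonempty.
  Connected : Set
  Connected = Fin n × (∀ u v → Star Adjacent u v)

  -- A cycle visits distinct vertices v₀, …, v₂₊ₖ in this order.
  record Cycle : Set where
    field
      {k}      : ℕ
      vertex   : Fin (3 ℕ.+ k) → Fin n
      distinct : Injective _≡_ _≡_ vertex
      step     : ∀ (i : Fin (2 ℕ.+ k)) → Adjacent (vertex (inject₁ i)) (vertex (suc i))
      close    : Adjacent (vertex (fromℕ (2 ℕ.+ k))) (vertex zero)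

  record IsTree : Set where
    field
      connected : Connected
      acyclic   : ¬ Cycle

  Proper : ∀ {m} → Vec (Fin m) n → Set
  Proper κ = ∀ u v → Adjacent u v → Vec.lookup κ u ≢ Vec.lookup κ v

  proper? : ∀ {m} (κ : Vec (Fin m) n) → Dec (Proper κ)
  proper? κ = Fin.all? λ u → Fin.all? λ v →
    T? (adjacent u v) →-dec ¬? (Vec.lookup κ u Fin.≟ Vec.lookup κ v)

colourings : ∀ n m → List (Vec (Fin m) n)
colourings zero    m = [] ∷ []
colourings (suc n) m = cartesianProductWith _∷_ (allFin m) (colourings n m)

-- κ contributes the monomial α: for every i, colour i is used αᵢ times.
HasContent : ∀ {n} (α : List ℕ) → Vec (Fin (length α)) n → Set
HasContent α κ = ∀ i → count (i Fin.≟_) κ ≡ lookup α i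

hasContent? : ∀ {n} α (κ : Vec (Fin (length α)) n) → Dec (HasContent α κ)
hasContent? α κ = Fin.all? λ i → count (i Fin.≟_) κ ℕ.≟ lookup α i

module _ {n} (G : Graph n) where

  Contributes : ∀ α → Vec (Fin (length α)) n → Set
  Contributes α κ = Proper G κ × HasContent α κ

  contributes? : ∀ α κ → Dec (Contributes α κ)
  contributes? α κ = proper? G κ ×-dec hasContent? α κ

  -- The coefficient of the monomial α counts the proper colourings κ with
  -- x_κ(v₁) ⋯ x_κ(vₙ) equal to that monomial; such a κ uses no colour
  -- beyond length α.
  chromaticSeries : Series
  chromaticSeries α = + length (filter (contributes? α) (colourings n (length α))) / 1

indicator : Bool → ℕ
indicator true  = 1
indicator false = 0

totalList : ∀ {A : Set} → (A → ℕ) → List A → ℕ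
totalList f []       = 0
totalList f (x ∷ xs) = f x ℕ.+ totalList f xs

total : ∀ n {m} → (Vec (Fin m) n → ℕ) → ℕ
total zero    f = f []
total (suc n) f = Σℕ.sum (λ i → total n (f ∘ (i ∷_)))

totalList-++ : ∀ {A : Set} (f : A → ℕ) xs ys →
  totalList f (xs ++ ys) ≡ totalList f xs ℕ.+ totalList f ys
totalList-++ f []       ys = refl
totalList-++ f (x ∷ xs) ys = ≡-trans (cong (f x ℕ.+_) (totalList-++ f xs ys)) (sym (ℕ.+-assoc (f x) _ _))

totalList-map : ∀ {A B : Set} (f : B → ℕ) (h : A → B) xs →
  totalList f (map h xs) ≡ totalList (f ∘ h) xs
totalList-map f h []       = refl
totalList-map f h (x ∷ xs) = cong (f (h x) ℕ.+_) (totalList-map f h xs)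

totalList-product : ∀ {m M n} (f : Vec (Fin M) (suc n) → ℕ) (g : Fin m → Fin M) L →
  totalList f (cartesianProductWith _∷_ (tabulate g) L) ≡ Σℕ.sum (λ i → totalList (f ∘ (g i ∷_)) L)
totalList-product {zero}  f g L = refl
totalList-product {suc m} f g L = ≡-trans
  (totalList-++ f (map (g zero ∷_) L) _)
  (cong₂ ℕ._+_ (totalList-map f (g zero ∷_) L) (totalList-product f (g ∘ suc) L))

totalList-colourings : ∀ n {m} (f : Vec (Fin m) n → ℕ) → totalList f (colourings n m) ≡ total n f
totalList-colourings zero    f = ℕ.+-identityʳ (f [])
totalList-colourings (suc n) f = ≡-trans (totalList-product f id (colourings n _))
  (Σℕ.sum-cong-≗ λ i → totalList-colourings n (f ∘ (i ∷_)))

length-filter : ∀ {A : Set} {P : Pred A 0ℓ} (P? : ∀ x → Dec (P x)) xs →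
  length (filter P? xs) ≡ totalList (indicator ∘ does ∘ P?) xs
length-filter P? []       = refl
length-filter P? (x ∷ xs) with does (P? x)
... | true  = cong suc (length-filter P? xs)
... | false = length-filter P? xs

total-cong : ∀ n {m} {f g : Vec (Fin m) n → ℕ} → f ≗ g → total n f ≡ total n g
total-cong zero    h = h []
total-cong (suc n) h = Σℕ.sum-cong-≗ λ i → total-cong n (h ∘ (i ∷_))

total-zero : ∀ n {m} {f : Vec (Fin m) n → ℕ} → (∀ κ → f κ ≡ 0) → total n f ≡ 0
total-zero zero        h = h []
total-zero (suc n) {m} h = ≡-trans (Σℕ.sum-cong-≗ λ i → total-zero n (h ∘ (i ∷_))) (Σℕ.sum-replicate-zero m)

total-permute : ∀ n {m m′} (π : Permutation m m′) (f : Vec (Fin m′) n → ℕ) →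
  total n f ≡ total n (f ∘ Vec.map (π ⟨$⟩ʳ_))
total-permute zero    π f = refl
total-permute (suc n) π f = ≡-trans (Σℕ.sum-permute _ π)
  (Σℕ.sum-cong-≗ λ i → total-permute n π (f ∘ ((π ⟨$⟩ʳ i) ∷_)))

total-unused : ∀ n {m} (f : Vec (Fin (suc m)) n → ℕ) →
  (∀ κ → count (zero Fin.≟_) κ ≢ 0 → f κ ≡ 0) → total n f ≡ total n (f ∘ Vec.map suc)
total-unused zero    f h = refl
total-unused (suc n) f h = cong₂ ℕ._+_
  (total-zero n (λ κ → h (zero ∷ κ) λ ()))
  (Σℕ.sum-cong-≗ λ i → total-unused n (f ∘ (suc i ∷_)) (λ κ → h (suc i ∷ κ)))

count-map : ∀ {m m′ n} (h : Fin m → Fin m′) → Injective _≡_ _≡_ h → ∀ i (κ : Vec (Fin m) n) →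
  count (h i Fin.≟_) (Vec.map h κ) ≡ count (i Fin.≟_) κ
count-map h inj i []      = refl
count-map h inj i (c ∷ κ) with h i Fin.≟ h c | i Fin.≟ c
... | yes _  | yes _  = cong suc (count-map h inj i κ)
... | no _   | no _   = count-map h inj i κ
... | yes eq | no ne  = ⊥-elim (ne (inj eq))
... | no ne  | yes eq = ⊥-elim (ne (cong h eq))

module _ {n} (G : Graph n) where

  proper-map : ∀ {m m′} (h : Fin m → Fin m′) → Injective _≡_ _≡_ h → ∀ κ →
    Proper G (Vec.map h κ) ⇔ Proper G κ
  proper-map h inj κ = mk⇔
    (λ p u v a eq → p u v a (≡-trans (Vec.lookup-map u h κ) (≡-trans (cong h eq) (sym (Vec.lookup-map v h κ)))))
    (λ p u v a eq → p u v a (inj (≡-trans (sym (Vec.lookup-map u h κ)) (≡-trans eq (Vec.lookup-map v h κ)))))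

  number : List ℕ → ℕ
  number α = total n (indicator ∘ does ∘ contributes? G α)

  chromatic-number : ∀ α → chromaticSeries G α ≡ + number α / 1
  chromatic-number α = cong (λ c → + c / 1)
    (≡-trans (length-filter (contributes? G α) (colourings n (length α)))
      (totalList-colourings n _))

  number-↭ : ∀ {α β} → α ↭ β → number α ≡ number β
  number-↭ {α} {β} p = sym (≡-trans (total-permute n π _)
    (total-cong n λ κ → cong indicator (does-⇔ (equiv κ) (contributes? G β (Vec.map h κ)) (contributes? G α κ))))
    where
    open import Data.List.Relation.Binary.Permutation.Setoid (Relation.Binary.PropositionalEquality.setoid ℕ)
      using (onIndices)
    open import Data.List.Relation.Binary.Permutation.Setoid.Properties (Relation.Binary.PropositionalEquality.setoid ℕ)
      using (onIndices-lookup)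
    π : Permutation (length α) (length β)
    π = onIndices (↭⇒↭ₛ p)
    h : Fin (length α) → Fin (length β)
    h = π ⟨$⟩ʳ_
    inj : Injective _≡_ _≡_ h
    inj {i} {j} eq = ≡-trans (sym (Perm.inverseˡ π)) (≡-trans (cong (π Perm.⟨$⟩ˡ_) eq) (Perm.inverseˡ π))
    content : ∀ i → lookup α i ≡ lookup β (h i)
    content = onIndices-lookup (↭⇒↭ₛ p)
    equiv : ∀ κ → Contributes G β (Vec.map h κ) ⇔ Contributes G α κ
    equiv κ = mk⇔
      (λ (p , q) → Function.Bundles.Equivalence.to (proper-map h inj κ) p ,
        λ i → ≡-trans (sym (count-map h inj i κ)) (≡-trans (q (h i)) (sym (content i))))
      (λ (p , q) → Function.Bundles.Equivalence.from (proper-map h inj κ) p ,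
        λ j → subst (λ j → count (j Fin.≟_) (Vec.map h κ) ≡ lookup β j) (Perm.inverseʳ π)
          (≡-trans (count-map h inj (π Perm.⟨$⟩ˡ j) κ) (≡-trans (q (π Perm.⟨$⟩ˡ j)) (content (π Perm.⟨$⟩ˡ j)))))

  number-0 : ∀ α → number (0 ∷ α) ≡ number α
  number-0 α = ≡-trans
    (total-unused n _ λ κ ne → cong indicator (dec-false (contributes? G (0 ∷ α) κ) λ (_ , q) → ne (q zero)))
    (total-cong n λ κ → cong indicator
      (does-⇔ (equiv κ) (contributes? G (0 ∷ α) (Vec.map suc κ)) (contributes? G α κ)))
    where
    unused : ∀ {k} (κ : Vec (Fin (length α)) k) → count (zero Fin.≟_) (Vec.map Fin.suc κ) ≡ 0
    unused []      = refl
    unused (_ ∷ κ) = unused κ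
    equiv : ∀ κ → Contributes G (0 ∷ α) (Vec.map suc κ) ⇔ Contributes G α κ
    equiv κ = mk⇔
      (λ (p , q) → Function.Bundles.Equivalence.to (proper-map suc Fin.suc-injective κ) p ,
        λ i → ≡-trans (sym (count-map suc Fin.suc-injective i κ)) (q (suc i)))
      (λ (p , q) → Function.Bundles.Equivalence.from (proper-map suc Fin.suc-injective κ) p ,
        λ { zero → unused κ ; (suc i) → ≡-trans (count-map suc Fin.suc-injective i κ) (q i) })

sum-lookup : ∀ α → sum α ≡ Σℕ.sum (lookup α)
sum-lookup []      = refl
sum-lookup (a ∷ α) = cong (a ℕ.+_) (sum-lookup α)

sum-single : ∀ {m} (c : Fin m) → Σℕ.sum (λ i → indicator (does (i Fin.≟ c))) ≡ 1
sum-single {suc m} zero    = cong suc (Σℕ.sum-replicate-zero m)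
sum-single {suc m} (suc c) = sum-single c

sum-count : ∀ {m n} (κ : Vec (Fin m) n) → Σℕ.sum (λ i → count (i Fin.≟_) κ) ≡ n
sum-count {m} []      = Σℕ.sum-replicate-zero m
sum-count {m} (c ∷ κ) = ≡-trans (Σℕ.sum-cong-≗ λ i → count-∷ i)
  (≡-trans (Σℕ.∑-distrib-+ {m} _ _) (cong₂ ℕ._+_ (sum-single c) (sum-count κ)))
  where
  count-∷ : ∀ i → count (i Fin.≟_) (c ∷ κ) ≡ indicator (does (i Fin.≟ c)) ℕ.+ count (i Fin.≟_) κ
  count-∷ i with does (i Fin.≟ c)
  ... | true  = refl
  ... | false = refl

X : ∀ {n} → Graph n → SymmetricFunction n
X {n} G = symmetric (chromaticSeries G) record
  { ↭-invariant = λ {α} {β} p → via α β (number-↭ G p)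
  ; 0-stable    = λ α → via (0 ∷ α) α (number-0 G α)
  ; homogeneous = λ α ne → ≡-trans (chromatic-number G α) (cong (λ c → + c / 1)
      (total-zero n λ κ → cong indicator (dec-false (contributes? G α κ) λ (_ , q) →
        ne (≡-trans (sum-lookup α) (≡-trans (sym (Σℕ.sum-cong-≗ q)) (sum-count κ))))))
  }
  where
  via : ∀ α β → number G α ≡ number G β → chromaticSeries G α ≡ chromaticSeries G β
  via α β eq = ≡-trans (chromatic-number G α)
    (≡-trans (cong (λ c → + c / 1) eq) (sym (chromatic-number G β)))

-- Division, totalised by p ÷₀ 0 = 0.  Below it is only applied to the
-- coefficient of eₙ in X G for connected G, which is positive.
infixl 7 _÷₀_
_÷₀_ : ℚ → ℚ → ℚ
p ÷₀ q with q ≟ 0ℚ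
... | yes _  = 0ℚ
... | no q≢0 = _÷_ p q {{≢-nonZero q≢0}}

Xₑ : ∀ {n} → Graph n → Graph n → SymmetricFunction n
Xₑ {n} G H = X G −[ [e n ∷ [] ] X G ÷₀ [e n ∷ [] ] X H ] X H

ConnectedGraph : ℕ → Set
ConnectedGraph n = Σ (Graph n) Connected

-- The elements of the poset are the classes of this setoid.
𝓔 : ℕ → Setoid 0ℓ 0ℓ
𝓔 n = record
  { Carrier       = ConnectedGraph n
  ; _≈_           = λ (G , _) (H , _) → X G ≈ X H
  ; isEquivalence = record
    { refl  = λ _ → refl
    ; sym   = λ p α → sym (p α)
    ; trans = λ p q α → ≡-trans (p α) (q α)
    }
  }

infix 4 _≥ₑ_ _≤ₑ_
_≥ₑ_ _≤ₑ_ : ∀ {n} → Rel (ConnectedGraph n) 0ℓ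
(G , _) ≥ₑ (H , _) = ePositive (Xₑ G H)
_≤ₑ_ = flip _≥ₑ_

Xₑ-cong : ∀ {n} {G G′ H H′ : Graph n} → X G ≈ X G′ → X H ≈ X H′ → Xₑ G H ≈ Xₑ G′ H′
Xₑ-cong {n} {G} {G′} {H} {H′} p q α =
  cong₂ _-_ (p α) (cong₂ _*_
    (cong₂ _÷₀_ ([e]-cong {F = X G} {X G′} p (n ∷ [])) ([e]-cong {F = X H} {X H′} q (n ∷ [])))
    (q α))

≤ₑ-respects : ∀ {n} → _≤ₑ_ {n} Respects₂ Setoid._≈_ (𝓔 n)
≤ₑ-respects {n} =
  (λ {(H , _)} {(G , _)} {(G′ , _)} p le ν ν⊢ → subst (0ℚ ≤_)
    ([e]-cong {F = Xₑ G H} {Xₑ G′ H} (Xₑ-cong {G = G} {G′} {H} {H} p (λ _ → refl)) ν) (le ν ν⊢)) ,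
  (λ {(G , _)} {(H , _)} {(H′ , _)} p le ν ν⊢ → subst (0ℚ ≤_)
    ([e]-cong {F = Xₑ G H} {Xₑ G H′} (Xₑ-cong {G = G} {G} {H} {H′} (λ _ → refl) p) ν) (le ν ν⊢))

Maximal : ∀ {A : Set} → Rel A 0ℓ → Pred A 0ℓ
Maximal _⊑_ x = ∀ y → x ⊑ y ⊎ y ⊑ x → y ⊑ x

{-# OPTIONS --safe #-}

-- Write c(G) for the coefficient of eₙ in X_G.  Every graph has the same coefficient n! at x₁⋯xₙ in X_G,
-- and that coefficient is positive in every e_ν with ν ⊢ n.  If F = Xₑ(H,T) is e-positive, its
-- coefficient n! (1 − c(H)/c(T)) at x₁⋯xₙ is therefore nonnegative, and it vanishes only if F = 0.
-- It thus suffices that c(H) ≥ n for every connected H and c(T) ≤ n for every tree T.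
--
-- The coefficient of eₙ in f is read off by the functional Σ_α (−1)^(n−ℓ(α)) α₁ f(α) over the
-- compositions α of n: it is 1 at eₙ and kills e_k g whenever 0 < k < n.  At X_G it is the sum
-- over the vertices r of a signed count of the surjective proper colourings that give r the first
-- colour.  (By Stanley's theorem this counts the acyclic orientations whose only sink is r.)
-- These counts satisfy deletion–contraction, and induction on the edges shows that they are ≥ 1 for
-- connected loopless multigraphs and ≤ 1 for multigraphs on k + 1 vertices with at most k edges.

module Submission where

open import Defs
open import Algebra.Bundles using (CommutativeRing)
import Algebra.Properties.Semiring.Sum
open import Data.Bool using (Bool; true; false; not; T; _∧_)
open import Data.Bool.Properties using (T?)
open import Data.Fin as Fin using (Fin; zero; suc; toℕ; fromℕ; fromℕ<; inject₁; punchIn; punchOut)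
import Data.Fin.Properties as Fin
import Data.Integer as ℤ
import Data.Integer.Properties as ℤ
open import Data.List using (List; []; _∷_; _++_; allFin; cartesianProduct; filter; length; lookup; map; replicate; tabulate)
import Data.List.Membership.DecPropositional
open import Data.List.Membership.Propositional using (_∈_)
open import Data.List.Membership.Propositional.Properties using (∈-allFin; ∈-cartesianProduct⁺; ∈-filter⁺; ∈-filter⁻; ∈-lookup)
import Data.List.Properties as List
open import Data.List.Relation.Binary.Permutation.Propositional using (prep; refl; swap)
open import Data.List.Relation.Unary.All using (All; []; _∷_)
import Data.List.Relation.Unary.All as All
import Data.List.Relation.Unary.All.Properties as All
open import Data.List.Relation.Unary.AllPairs using ([]; _∷_)
open import Data.List.Relation.Unary.Any using (here; there)
open import Data.List.Relation.Unary.Linked using ([-]; linked?)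
open import Data.List.Relation.Unary.Unique.Propositional using (Unique)
import Data.List.Relation.Unary.Unique.Propositional.Properties as Unique
open import Data.Nat as ℕ using (ℕ; zero; suc; _∸_; z≤n; s≤s; _≥?_)
open import Data.Nat.ListAction using (sum)
import Data.Nat.Properties as ℕ
open import Data.Product as Product using (Σ-syntax; ∃-syntax; _×_; _,_; proj₁; proj₂; uncurry)
open import Data.Rational using (ℚ; 0ℚ; 1ℚ; _+_; _*_; -_; _-_; _/_; 1/_; _≤_; _<_; _≟_; _≤?_; NonZero; ≢-nonZero; nonNegative; positive; toℚᵘ)
import Data.Rational.Properties as ℚ
open import Data.Rational.Solver using (module +-*-Solver)
open import Data.Rational.Unnormalised using (mkℚᵘ; *≡*; _≃_)
import Data.Rational.Unnormalised as ℚᵘ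
import Data.Rational.Unnormalised.Properties as ℚᵘ
open import Data.Sum using (_⊎_; inj₁; inj₂; [_,_]′)
open import Data.Vec using (Vec; []; _∷_; count; insertAt)
import Data.Vec as Vec
import Data.Vec.Properties as Vec
open import Function using (_∘_; id; Injective)
open import Function.Bundles using (Equivalence; _⇔_; mk⇔)
open import Level using (0ℓ)
open import Relation.Binary using (Rel; tri<; tri≈; tri>)
open import Relation.Binary.Construct.Closure.ReflexiveTransitive using (Star; ε; _◅_; _◅◅_)
import Relation.Binary.Construct.Closure.ReflexiveTransitive as Star
open import Relation.Binary.PropositionalEquality
open import Relation.Nullary using (Dec; yes; no; does; ¬_)
open import Relation.Nullary.Decidable using (_×-dec_; ¬?; dec-false; dec-true; does-⇔; toWitness)
open import Relation.Nullary.Negation using (contradiction)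

open +-*-Solver using (solve; con; _:+_; _:*_; _:-_; :-_; _:=_)
open SymmetricFunction using (coeff)

-- The functional is the Hall pairing with (-1)^(n-1) pₙ: pairing with h_α reads off the coefficient
-- at x^α, and pₙ is the sum of (-1)^(ℓ(α)-1) α₁ h_α over the compositions α of n. It kills products
-- because pₙ is primitive. Without the weight α₁ the same sum is the pairing with eₙ, which is 1 at
-- every e_ν; this is `alt`, on which the weighted recursion leans. No Hall pairing is constructed:
-- both facts about products come from peeling off the first variable. The bound n is the number of
-- candidates for the sink r, each of which contributes separately. The contributions are defined as
-- signed counts of colourings, where neither bound is visible. Contraction loses a vertex and so
-- flips the sign, which turns deletion-contraction into a recursion with plus signs only. It also
-- creates parallel edges and loops, so the induction works with lists of edges instead of `Graph`.

module Σ*ℕ = Algebra.Properties.Semiring.Sum ℕ.+-*-semiring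
module Σ*ℚ = Algebra.Properties.Semiring.Sum (CommutativeRing.semiring ℚ.+-*-commutativeRing)

-- Natural numbers as rationals

⟦_⟧ : ℕ → ℚ
⟦ k ⟧ = ℤ.+ k / 1

toℚᵘ-⟦⟧ : ∀ k → toℚᵘ ⟦ k ⟧ ≃ mkℚᵘ (ℤ.+ k) 0
toℚᵘ-⟦⟧ k = ℚ.toℚᵘ-fromℚᵘ (mkℚᵘ (ℤ.+ k) 0)

⟦⟧-+ : ∀ a b → ⟦ a ℕ.+ b ⟧ ≡ ⟦ a ⟧ + ⟦ b ⟧
⟦⟧-+ a b = ℚ.toℚᵘ-injective (ℚᵘ.≃-trans (toℚᵘ-⟦⟧ (a ℕ.+ b))
  (ℚᵘ.≃-trans (*≡* (cong (ℤ._* ℤ.+ 1) (sym (cong₂ ℤ._+_ (ℤ.*-identityʳ (ℤ.+ a)) (ℤ.*-identityʳ (ℤ.+ b))))))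
  (ℚᵘ.≃-sym (ℚᵘ.≃-trans (ℚ.toℚᵘ-homo-+ ⟦ a ⟧ ⟦ b ⟧) (ℚᵘ.+-cong (toℚᵘ-⟦⟧ a) (toℚᵘ-⟦⟧ b))))))

⟦⟧-* : ∀ a b → ⟦ a ℕ.* b ⟧ ≡ ⟦ a ⟧ * ⟦ b ⟧
⟦⟧-* a b = ℚ.toℚᵘ-injective (ℚᵘ.≃-trans (toℚᵘ-⟦⟧ (a ℕ.* b))
  (ℚᵘ.≃-trans (*≡* (cong (ℤ._* ℤ.+ 1) (ℤ.pos-* a b)))
  (ℚᵘ.≃-sym (ℚᵘ.≃-trans (ℚ.toℚᵘ-homo-* ⟦ a ⟧ ⟦ b ⟧) (ℚᵘ.*-cong (toℚᵘ-⟦⟧ a) (toℚᵘ-⟦⟧ b))))))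

⟦⟧-mono : ∀ {a b} → a ℕ.≤ b → ⟦ a ⟧ ≤ ⟦ b ⟧
⟦⟧-mono {a} {b} p = ℚ.toℚᵘ-cancel-≤ (ℚᵘ.≤-respˡ-≃ (ℚᵘ.≃-sym (toℚᵘ-⟦⟧ a))
  (ℚᵘ.≤-respʳ-≃ (ℚᵘ.≃-sym (toℚᵘ-⟦⟧ b)) (ℚᵘ.*≤* (ℤ.*-monoʳ-≤-nonNeg (ℤ.+ 1) (ℤ.+≤+ p)))))

-- The functional that extracts the coefficient of eₙ

-- The coefficient of x₁^a, as a series in the remaining variables.
D : ℕ → Series → Series
D a f α = f (a ∷ α)

-- alt q f is the sum of (−1)^(q−ℓ(α)) f(α) over the compositions α of q.  In alt≥ and wt≥ the sum
-- is over the compositions α of q + a − 1 with α₁ ≥ a, the sign is divided by (−1)^(a−1), and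
-- wt≥ has the extra weight α₁.
alt : ℕ → Series → ℚ
alt≥ : ℕ → ℕ → Series → ℚ
alt zero    f = f []
alt (suc q) f = alt q (D 1 f) - alt≥ q 2 f
alt≥ zero    a f = 0ℚ
alt≥ (suc q) a f = alt q (D a f) - alt≥ q (suc a) f

wt≥ : ℕ → ℕ → Series → ℚ
wt≥ zero    a f = 0ℚ
wt≥ (suc q) a f = ⟦ a ⟧ * alt q (D a f) - wt≥ q (suc a) f

-- A composition of `q` has at most `q` parts. The bound on the length makes `chromatic-Σ`
-- applicable under the functional, since that identity holds only up to as many colours as
-- vertices.
alt-cong : ∀ q {f g} → (∀ α → length α ℕ.≤ q → f α ≡ g α) → alt q f ≡ alt q g
alt≥-cong : ∀ q a {f g} → (∀ a α → length α ℕ.< q → f (a ∷ α) ≡ g (a ∷ α)) → alt≥ q a f ≡ alt≥ q a g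
alt-cong zero    h = h [] ℕ.z≤n
alt-cong (suc q) h = cong₂ _-_ (alt-cong q λ α l → h (1 ∷ α) (ℕ.s≤s l))
  (alt≥-cong q 2 λ a α l → h (a ∷ α) (ℕ.s≤s (ℕ.<⇒≤ l)))
alt≥-cong zero    a h = refl
alt≥-cong (suc q) a h = cong₂ _-_ (alt-cong q λ α l → h a α (ℕ.s≤s l))
  (alt≥-cong q (suc a) λ a α l → h a α (ℕ.m≤n⇒m≤1+n l))

wt≥-cong : ∀ q a {f g} → (∀ a α → length α ℕ.< q → f (a ∷ α) ≡ g (a ∷ α)) → wt≥ q a f ≡ wt≥ q a g
wt≥-cong zero    a h = refl
wt≥-cong (suc q) a h = cong₂ (λ x y → ⟦ a ⟧ * x - y) (alt-cong q λ α l → h a α (ℕ.s≤s l))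
  (wt≥-cong q (suc a) λ a α l → h a α (ℕ.m≤n⇒m≤1+n l))

minus-lin : ∀ c x y z w → (x + c * y) - (z + c * w) ≡ (x - z) + c * (y - w)
minus-lin = solve 5 (λ c x y z w → (x :+ c :* y) :- (z :+ c :* w) := (x :- z) :+ c :* (y :- w)) refl

*-lin : ∀ c v x y → v * (x + c * y) ≡ v * x + c * (v * y)
*-lin = solve 4 (λ c v x y → v :* (x :+ c :* y) := v :* x :+ c :* (v :* y)) refl

alt-lin : ∀ q c f g → alt q (λ α → f α + c * g α) ≡ alt q f + c * alt q g
alt≥-lin : ∀ q a c f g → alt≥ q a (λ α → f α + c * g α) ≡ alt≥ q a f + c * alt≥ q a g
alt-lin zero    c f g = refl
alt-lin (suc q) c f g = trans (cong₂ _-_ (alt-lin q c (D 1 f) (D 1 g)) (alt≥-lin q 2 c f g))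
  (minus-lin c (alt q (D 1 f)) (alt q (D 1 g)) (alt≥ q 2 f) (alt≥ q 2 g))
alt≥-lin zero    a c f g = sym (trans (ℚ.+-identityˡ _) (ℚ.*-zeroʳ c))
alt≥-lin (suc q) a c f g = trans (cong₂ _-_ (alt-lin q c (D a f) (D a g)) (alt≥-lin q (suc a) c f g))
  (minus-lin c (alt q (D a f)) (alt q (D a g)) (alt≥ q (suc a) f) (alt≥ q (suc a) g))

wt≥-lin : ∀ q a c f g → wt≥ q a (λ α → f α + c * g α) ≡ wt≥ q a f + c * wt≥ q a g
wt≥-lin zero    a c f g = sym (trans (ℚ.+-identityˡ _) (ℚ.*-zeroʳ c))
wt≥-lin (suc q) a c f g = trans
  (cong₂ _-_ (trans (cong (⟦ a ⟧ *_) (alt-lin q c (D a f) (D a g)))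
      (*-lin c ⟦ a ⟧ (alt q (D a f)) (alt q (D a g))))
    (wt≥-lin q (suc a) c f g))
  (minus-lin c (⟦ a ⟧ * alt q (D a f)) (⟦ a ⟧ * alt q (D a g)) (wt≥ q (suc a) f) (wt≥ q (suc a) g))

alt≥-zero : ∀ q a f → (∀ b α → a ℕ.≤ b → f (b ∷ α) ≡ 0ℚ) → alt≥ q a f ≡ 0ℚ
alt-zero : ∀ q f → (∀ α → f α ≡ 0ℚ) → alt q f ≡ 0ℚ
alt-zero zero    f h = h []
alt-zero (suc q) f h = cong₂ _-_ (alt-zero q (D 1 f) λ α → h (1 ∷ α)) (alt≥-zero q 2 f λ b α _ → h (b ∷ α))
alt≥-zero zero    a f h = refl
alt≥-zero (suc q) a f h = cong₂ _-_ (alt-zero q (D a f) λ α → h a α ℕ.≤-refl)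
  (alt≥-zero q (suc a) f λ b α l → h b α (ℕ.≤-trans (ℕ.n≤1+n a) l))

wt≥-zero : ∀ q a f → (∀ b α → a ℕ.≤ b → f (b ∷ α) ≡ 0ℚ) → wt≥ q a f ≡ 0ℚ
wt≥-zero zero    a f h = refl
wt≥-zero (suc q) a f h = trans (cong₂ (λ x y → ⟦ a ⟧ * x - y) (alt-zero q (D a f) λ α → h a α ℕ.≤-refl)
  (wt≥-zero q (suc a) f λ b α l → h b α (ℕ.≤-trans (ℕ.n≤1+n a) l)))
  (solve 1 (λ x → x :* con 0ℚ :- con 0ℚ := con 0ℚ) refl ⟦ a ⟧)

D-sym : ∀ a {d f} → IsSymmetric (a ℕ.+ d) f → IsSymmetric d (D a f)
D-sym a {d} {f} S = record
  { ↭-invariant = λ p → ↭-invariant (prep a p)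
  ; 0-stable    = λ α → trans (↭-invariant (swap a 0 refl)) (0-stable (a ∷ α))
  ; homogeneous = λ α ne → homogeneous (a ∷ α) (ne ∘ ℕ.+-cancelˡ-≡ a _ _)
  }
  where open IsSymmetric S

e0-⊛ : ∀ g → e 0 ⊛ g ≗ g
e0-⊛ g []      = ℚ.*-identityˡ (g [])
e0-⊛ g (a ∷ α) = trans
  (cong₂ _+_ (trans (⊛-cong (e-zero 0) (λ _ → refl) α) (e0-⊛ (D a g) α))
     (∑-zero {a} _ λ i → ⊛-zeroˡ _ (λ _ → refl) α))
  (ℚ.+-identityʳ _)

-- A monomial of `e (suc k)` contains the first variable at most once, so only the exponents 0 and 1
-- survive in the first factor. The `1ℚ` gives the sum the shape of `alt-lin`.
D-e⊛ : ∀ k a g → D (suc a) (e (suc k) ⊛ g) ≗ λ α → (e (suc k) ⊛ D (suc a) g) α + 1ℚ * (e k ⊛ D a g) α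
D-e⊛ k a g α = cong ((e (suc k) ⊛ D (suc a) g) α +_) (trans
  (cong ((e k ⊛ D a g) α +_) (∑-zero {a} _ λ i →
      ⊛-zeroˡ (λ γ → g (suc a ∸ toℕ (suc (suc i)) ∷ γ)) (λ _ → refl) α))
  (trans (ℚ.+-identityʳ ((e k ⊛ D a g) α)) (sym (ℚ.*-identityˡ ((e k ⊛ D a g) α)))))

D-above : ∀ {d f} → IsSymmetric d f → ∀ a α → d ℕ.< a → D a f α ≡ 0ℚ
D-above S a α lt = IsSymmetric.homogeneous S (a ∷ α)
  (λ eq → ℕ.<⇒≱ lt (subst (a ℕ.≤_) eq (ℕ.m≤m+n a _)))

alt-D0 : ∀ {d g} → IsSymmetric d g → ∀ q → alt q (D 0 g) ≡ alt q g
alt-D0 S q = alt-cong q λ α _ → IsSymmetric.0-stable S α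

alt-lin₁ : ∀ q {f} g h → (∀ α → f α ≡ g α + 1ℚ * h α) → alt q f ≡ alt q g + alt q h
alt-lin₁ q g h eq = trans (alt-cong q λ α _ → eq α)
  (trans (alt-lin q 1ℚ g h) (cong (alt q g +_) (ℚ.*-identityˡ _)))

-- Since D (suc a) (e (suc k) ⊛ g) = e (suc k) ⊛ D (suc a) g + e k ⊛ D a g, every D a g with a ≥ 1
-- occurs twice, with opposite signs, and the sums telescope.
alt-e⊛ : ∀ k q {g} → IsSymmetric q g → alt (k ℕ.+ q) (e k ⊛ g) ≡ alt q g
alt≥-e⊛ : ∀ k q a {g} → IsSymmetric (a ℕ.+ q) g →
        alt≥ (suc k ℕ.+ q) (suc a) (e (suc k) ⊛ g) ≡ alt q (D a g)
alt-D-e⊛ : ∀ k q a {g} → IsSymmetric (a ℕ.+ suc q) g →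
         alt (k ℕ.+ suc q) (e (suc k) ⊛ D (suc a) g) ≡ alt q (D (suc a) g)

⊛-zeroʳ : ∀ f {g} → g ≗ (λ _ → 0ℚ) → f ⊛ g ≗ (λ _ → 0ℚ)
⊛-zeroʳ f p []      = trans (cong (f [] *_) (p [])) (ℚ.*-zeroʳ (f []))
⊛-zeroʳ f p (a ∷ α) = ∑-zero {suc a} _ λ i →
  ⊛-zeroʳ (λ β → f (toℕ i ∷ β)) (λ γ → p (a ∸ toℕ i ∷ γ)) α

-- The first variable has exponent at most 1 in `e (suc k)` and at most `d` in `g`.
e⊛-above : ∀ k {d g} → IsSymmetric d g → ∀ a α → suc d ℕ.< a → D a (e (suc k) ⊛ g) α ≡ 0ℚ
e⊛-above k {g = g} S (suc a) α (ℕ.s≤s lt) = trans (D-e⊛ k a g α) (cong₂ (λ x y → x + 1ℚ * y)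
  (⊛-zeroʳ (e (suc k)) (λ β → D-above S (suc a) β (ℕ.m≤n⇒m≤1+n lt)) α)
  (⊛-zeroʳ (e k) (λ β → D-above S a β lt) α))

alt-e⊛ zero    q S = alt-cong q λ α _ → e0-⊛ _ α
alt-e⊛ (suc k) q S = trans (alt≥-e⊛ k q 0 S) (alt-D0 S q)

alt-D-e⊛ k q a {g} S = trans (cong (λ n → alt n (e (suc k) ⊛ D (suc a) g)) (ℕ.+-suc k q))
  (alt-e⊛ (suc k) q (D-sym (suc a) (subst (λ d → IsSymmetric d g) (ℕ.+-suc a q) S)))

alt≥-e⊛ k zero a {g} S = begin
  alt (k ℕ.+ 0) (D (suc a) (e (suc k) ⊛ g)) - alt≥ (k ℕ.+ 0) (suc (suc a)) (e (suc k) ⊛ g)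
    ≡⟨ cong₂ _-_ (alt-lin₁ (k ℕ.+ 0) (e (suc k) ⊛ D (suc a) g) (e k ⊛ D a g) (D-e⊛ k a g))
         (alt≥-zero (k ℕ.+ 0) (suc (suc a)) (e (suc k) ⊛ g)
             (λ b α lt → e⊛-above k S b α (subst (λ d → suc d ℕ.< b) (sym (ℕ.+-identityʳ a)) lt))) ⟩
  alt (k ℕ.+ 0) (e (suc k) ⊛ D (suc a) g) + alt (k ℕ.+ 0) (e k ⊛ D a g) - 0ℚ
    ≡⟨ cong₂ (λ x y → x + y - 0ℚ)
         (alt-zero (k ℕ.+ 0) (e (suc k) ⊛ D (suc a) g)
             (⊛-zeroʳ (e (suc k)) (λ β → D-above S (suc a) β (ℕ.s≤s (ℕ.≤-reflexive (ℕ.+-identityʳ a))))))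
         (alt-e⊛ k 0 (D-sym a S)) ⟩
  0ℚ + alt 0 (D a g) - 0ℚ
    ≡⟨ solve 1 (λ x → con 0ℚ :+ x :- con 0ℚ := x) refl (alt 0 (D a g)) ⟩
  alt 0 (D a g) ∎
  where open ≡-Reasoning
alt≥-e⊛ k (suc q) a {g} S = begin
  alt (k ℕ.+ suc q) (D (suc a) (e (suc k) ⊛ g)) - alt≥ (k ℕ.+ suc q) (suc (suc a)) (e (suc k) ⊛ g)
    ≡⟨ cong₂ _-_ (alt-lin₁ (k ℕ.+ suc q) (e (suc k) ⊛ D (suc a) g) (e k ⊛ D a g) (D-e⊛ k a g))
         (cong (λ n → alt≥ n (suc (suc a)) (e (suc k) ⊛ g)) (ℕ.+-suc k q)) ⟩
  alt (k ℕ.+ suc q) (e (suc k) ⊛ D (suc a) g) + alt (k ℕ.+ suc q) (e k ⊛ D a g)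
      - alt≥ (suc k ℕ.+ q) (suc (suc a)) (e (suc k) ⊛ g)
    ≡⟨ cong₂ _-_ (cong₂ _+_ (alt-D-e⊛ k q a S) (alt-e⊛ k (suc q) (D-sym a S)))
         (alt≥-e⊛ k q (suc a) (subst (λ d → IsSymmetric d g) (ℕ.+-suc a q) S)) ⟩
  alt q (D (suc a) g) + alt (suc q) (D a g) - alt q (D (suc a) g)
    ≡⟨ solve 2 (λ x y → x :+ y :- x := y) refl (alt q (D (suc a) g)) (alt (suc q) (D a g)) ⟩
  alt (suc q) (D a g) ∎
  where open ≡-Reasoning

-- For b > a, `D b g` occurs with the weights b and b + 1 and opposite signs, so one copy of it
-- remains; these copies make up `alt≥ q (suc a) g`. Only `D a g` occurs once, with weight `suc a`.
wt≥-e⊛ : ∀ k q a {g} → IsSymmetric (a ℕ.+ q) g →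
        wt≥ (suc k ℕ.+ q) (suc a) (e (suc k) ⊛ g) ≡ ⟦ suc a ⟧ * alt q (D a g) - alt≥ q (suc a) g
wt≥-e⊛ k zero a {g} S = begin
  ⟦ suc a ⟧ * alt (k ℕ.+ 0) (D (suc a) (e (suc k) ⊛ g)) - wt≥ (k ℕ.+ 0) (suc (suc a)) (e (suc k) ⊛ g)
    ≡⟨ cong₂ (λ x y → ⟦ suc a ⟧ * x - y)
        (alt-lin₁ (k ℕ.+ 0) (e (suc k) ⊛ D (suc a) g) (e k ⊛ D a g) (D-e⊛ k a g))
         (wt≥-zero (k ℕ.+ 0) (suc (suc a)) (e (suc k) ⊛ g)
             (λ b α lt → e⊛-above k S b α (subst (λ d → suc d ℕ.< b) (sym (ℕ.+-identityʳ a)) lt))) ⟩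
  ⟦ suc a ⟧ * (alt (k ℕ.+ 0) (e (suc k) ⊛ D (suc a) g) + alt (k ℕ.+ 0) (e k ⊛ D a g)) - 0ℚ
    ≡⟨ cong₂ (λ x y → ⟦ suc a ⟧ * (x + y) - 0ℚ)
         (alt-zero (k ℕ.+ 0) (e (suc k) ⊛ D (suc a) g)
             (⊛-zeroʳ (e (suc k)) (λ β → D-above S (suc a) β (ℕ.s≤s (ℕ.≤-reflexive (ℕ.+-identityʳ a))))))
         (alt-e⊛ k 0 (D-sym a S)) ⟩
  ⟦ suc a ⟧ * (0ℚ + alt 0 (D a g)) - 0ℚ
    ≡⟨ cong (λ x → ⟦ suc a ⟧ * x - 0ℚ) (ℚ.+-identityˡ _) ⟩
  ⟦ suc a ⟧ * alt 0 (D a g) - 0ℚ ∎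
  where open ≡-Reasoning
wt≥-e⊛ k (suc q) a {g} S = begin
  ⟦ suc a ⟧ * alt (k ℕ.+ suc q) (D (suc a) (e (suc k) ⊛ g))
      - wt≥ (k ℕ.+ suc q) (suc (suc a)) (e (suc k) ⊛ g)
    ≡⟨ cong₂ (λ x y → ⟦ suc a ⟧ * x - y)
        (alt-lin₁ (k ℕ.+ suc q) (e (suc k) ⊛ D (suc a) g) (e k ⊛ D a g) (D-e⊛ k a g))
         (cong (λ n → wt≥ n (suc (suc a)) (e (suc k) ⊛ g)) (ℕ.+-suc k q)) ⟩
  ⟦ suc a ⟧ * (alt (k ℕ.+ suc q) (e (suc k) ⊛ D (suc a) g) + alt (k ℕ.+ suc q) (e k ⊛ D a g))
      - wt≥ (suc k ℕ.+ q) (suc (suc a)) (e (suc k) ⊛ g)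
    ≡⟨ cong₂ (λ x y → ⟦ suc a ⟧ * x - y) (cong₂ _+_ (alt-D-e⊛ k q a S) (alt-e⊛ k (suc q) (D-sym a S)))
         (trans (wt≥-e⊛ k q (suc a) (subst (λ d → IsSymmetric d g) (ℕ.+-suc a q) S))
           (cong (λ z → z * alt q (D (suc a) g) - alt≥ q (suc (suc a)) g) (⟦⟧-+ 1 (suc a)))) ⟩
  ⟦ suc a ⟧ * (alt q (D (suc a) g) + alt (suc q) (D a g))
      - ((1ℚ + ⟦ suc a ⟧) * alt q (D (suc a) g) - alt≥ q (suc (suc a)) g)
    ≡⟨ solve 4 (λ c x y z → c :* (x :+ y) :- ((con 1ℚ :+ c) :* x :- z) := c :* y :- (x :- z)) refl
         ⟦ suc a ⟧ (alt q (D (suc a) g)) (alt (suc q) (D a g)) (alt≥ q (suc (suc a)) g) ⟩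
  ⟦ suc a ⟧ * alt (suc q) (D a g) - alt≥ (suc q) (suc a) g ∎
  where open ≡-Reasoning

wt : ℕ → Series → ℚ
wt n = wt≥ n 1

-- At `a = 0` the two remaining terms agree: `D 0 g` is `g`, and in positive degree every
-- composition has first part at least 1. In degree 0 the second term is empty instead, whence the
-- value 1 in `wt-e`.
wt-product : ∀ k q {g} → IsSymmetric (suc q) g → wt (suc k ℕ.+ suc q) (e (suc k) ⊛ g) ≡ 0ℚ
wt-product k q {g} S = trans (wt≥-e⊛ k (suc q) 0 S)
  (trans (cong (λ x → 1ℚ * x - alt (suc q) g) (alt-D0 S (suc q)))
    (solve 1 (λ x → con 1ℚ :* x :- x := con 0ℚ) refl (alt (suc q) g)))

wt-e : ∀ k → wt (suc k ℕ.+ 0) (e (suc k) ⊛ e 0) ≡ 1ℚ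
wt-e k = wt≥-e⊛ k 0 0 (e-sym 0)

wt-∑∈ : ∀ n {I : Set} (L : List I) (c : I → ℚ) (f : I → Series) →
  wt n (λ α → ∑∈ L (λ i → c i * f i α)) ≡ ∑∈ L (λ i → c i * wt n (f i))
wt-∑∈ n []      c f = wt≥-zero n 1 (λ _ → 0ℚ) (λ _ _ _ → refl)
wt-∑∈ n (i ∷ L) c f = begin
  wt n (λ α → c i * f i α + ∑∈ L (λ j → c j * f j α))
    ≡⟨ wt≥-cong n 1 (λ a α _ → ℚ.+-comm (c i * f i (a ∷ α)) _) ⟩
  wt n (λ α → ∑∈ L (λ j → c j * f j α) + c i * f i α)
    ≡⟨ wt≥-lin n 1 (c i) (λ α → ∑∈ L (λ j → c j * f j α)) (f i) ⟩
  wt n (λ α → ∑∈ L (λ j → c j * f j α)) + c i * wt n (f i)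
    ≡⟨ ℚ.+-comm _ (c i * wt n (f i)) ⟩
  c i * wt n (f i) + wt n (λ α → ∑∈ L (λ j → c j * f j α))
    ≡⟨ cong (c i * wt n (f i) +_) (wt-∑∈ n L c f) ⟩
  c i * wt n (f i) + ∑∈ L (λ j → c j * wt n (f j)) ∎
  where open ≡-Reasoning

-- The one-part partition in the e-expansion

∑∈-++-zero : ∀ {I : Set} (xs ys : List I) (f : I → ℚ) → All (λ x → f x ≡ 0ℚ) xs → ∑∈ (xs ++ ys) f ≡ ∑∈ ys f
∑∈-++-zero []       ys f []       = refl
∑∈-++-zero (x ∷ xs) ys f (p ∷ ps) = trans (cong₂ _+_ p (∑∈-++-zero xs ys f ps)) (ℚ.+-identityˡ _)

-- The one-part partition is lexicographically greatest, so it closes the list; all others have at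
-- least two parts and are killed by `wt`.
EndsWith : ℕ → List (List ℕ) → Set
EndsWith n L = ∃[ xs ] L ≡ xs ++ (n ∷ []) ∷ [] × All (λ κ → 2 ℕ.≤ length κ) xs

incHead-length : ∀ {m} κ → suc m ℕ.≤ length κ → suc m ℕ.≤ length (incHead κ)
incHead-length (_ ∷ _) p = p

compositions-nonempty : ∀ n → All (λ κ → 1 ℕ.≤ length κ) (compositions (suc n))
compositions-nonempty zero    = ℕ.s≤s ℕ.z≤n ∷ []
compositions-nonempty (suc n) = All.++⁺
  (All.map⁺ (All.universal (λ _ → ℕ.s≤s ℕ.z≤n) (compositions (suc n))))
  (All.map⁺ (All.map (λ {κ} → incHead-length κ) (compositions-nonempty n)))

compositions-endsWith : ∀ n → EndsWith (suc n) (compositions (suc n))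
compositions-endsWith zero    = [] , refl , []
compositions-endsWith (suc n) with compositions-endsWith n
... | xs , eq , long = map (1 ∷_) (compositions (suc n)) ++ map incHead xs ,
  trans (cong (λ L → map (1 ∷_) (compositions (suc n)) ++ map incHead L) eq)
    (trans (cong (map (1 ∷_) (compositions (suc n)) ++_) (List.map-++ incHead xs _))
      (sym (List.++-assoc (map (1 ∷_) (compositions (suc n))) (map incHead xs) _))) ,
  All.++⁺ (All.map⁺ (All.map ℕ.s≤s (compositions-nonempty n)))
          (All.map⁺ (All.map (λ {κ} → incHead-length κ) long))

partitions-endsWith : ∀ n → EndsWith (suc n) (partitions (suc n))
partitions-endsWith n with compositions-endsWith n
... | xs , eq , long = filter (linked? _≥?_) xs ,
  trans (cong (filter (linked? _≥?_)) eq)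
    (trans (List.filter-++ (linked? _≥?_) xs _)
      (cong (filter (linked? _≥?_) xs ++_) (List.filter-accept (linked? _≥?_) {xs = []} [-]))) ,
  All.filter⁺ (linked? _≥?_) long

wt-eProduct : ∀ {n ν} → ν ⊢ n → 2 ℕ.≤ length ν → wt n (eProduct ν) ≡ 0ℚ
wt-eProduct {n} {suc k ∷ suc l ∷ ν} ν⊢ _ = subst (λ m → wt m (eProduct (suc k ∷ suc l ∷ ν)) ≡ 0ℚ)
    (_⊢_.parts-sum ν⊢)
  (wt-product k (l ℕ.+ sum ν) (eProduct-sym (suc l ∷ ν)))
wt-eProduct {n} {k ∷ []} ν⊢ (ℕ.s≤s ())
wt-eProduct {n} {zero ∷ _ ∷ ν} ν⊢ _ with _⊢_.parts-positive ν⊢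
... | () ∷ _
wt-eProduct {n} {suc _ ∷ zero ∷ ν} ν⊢ _ with _⊢_.parts-positive ν⊢
... | _ ∷ () ∷ _

[eₙ]≡wt : ∀ n (F : SymmetricFunction (suc n)) → [e suc n ∷ [] ] F ≡ wt (suc n) (coeff F)
[eₙ]≡wt n F with partitions-endsWith n
... | xs , eq , long = sym (begin
  wt (suc n) (coeff F)
    ≡⟨ wt≥-cong (suc n) 1 (λ a α _ → eExpansion.expands (eExpand F) (a ∷ α)) ⟩
  wt (suc n) (λ α → ∑∈ (partitions (suc n)) (λ ν → c ν * eProduct ν α))
    ≡⟨ wt-∑∈ (suc n) (partitions (suc n)) c eProduct ⟩
  ∑∈ (partitions (suc n)) term
    ≡⟨ cong (λ L → ∑∈ L term) eq ⟩
  ∑∈ (xs ++ (suc n ∷ []) ∷ []) term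
    ≡⟨ ∑∈-++-zero xs _ term (All.map
        (λ (p , ν⊢) → trans (cong (c _ *_) (wt-eProduct ν⊢ p)) (ℚ.*-zeroʳ (c _)))
         (All.zip (long , All.++⁻ˡ xs (subst (All (_⊢ suc n)) eq
             (All.tabulate (Equivalence.to ∈-partitions)))))) ⟩
  c (suc n ∷ []) * wt (suc n) (eProduct (suc n ∷ [])) + 0ℚ
    ≡⟨ trans (ℚ.+-identityʳ _) (cong (c (suc n ∷ []) *_)
         (subst (λ m → wt m (eProduct (suc n ∷ [])) ≡ 1ℚ) (ℕ.+-identityʳ (suc n)) (wt-e n))) ⟩
  c (suc n ∷ []) * 1ℚ
    ≡⟨ ℚ.*-identityʳ _ ⟩
  c (suc n ∷ []) ∎)
  where
  open ≡-Reasoning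
  c : List ℕ → ℚ
  c ν = [e ν ] F
  term : List ℕ → ℚ
  term ν = c ν * wt (suc n) (eProduct ν)

-- Evaluation at the chromatic symmetric function

sgn : ℕ → ℚ
sgn zero    = 1ℚ
sgn (suc k) = - sgn k

sgn-+ : ∀ a b → sgn (a ℕ.+ b) ≡ sgn a * sgn b
sgn-+ zero    b = sym (ℚ.*-identityˡ _)
sgn-+ (suc a) b = trans (cong -_ (sgn-+ a b)) (ℚ.neg-distribˡ-* (sgn a) (sgn b))

_≟ₗ_ : (α β : List ℕ) → Dec (α ≡ β)
_≟ₗ_ = List.≡-dec ℕ._≟_

δ : List ℕ → List ℕ → ℕ
δ c α = indicator (does (c ≟ₗ α))

pos : List ℕ → ℕ
pos c = indicator (does (All.all? (0 ℕ.<?_) c))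

δℚ : List ℕ → Series
δℚ c α = ⟦ δ c α ⟧

D-δ-≡ : ∀ a c α → D a (δℚ (a ∷ c)) α ≡ δℚ c α
D-δ-≡ a c α = cong (⟦_⟧ ∘ indicator)
  (does-⇔ (mk⇔ List.∷-injectiveʳ (cong (a ∷_))) ((a ∷ c) ≟ₗ (a ∷ α)) (c ≟ₗ α))

D-δ-≢ : ∀ {a c₀} c α → c₀ ≢ a → D a (δℚ (c₀ ∷ c)) α ≡ 0ℚ
D-δ-≢ {a} {c₀} c α ne = cong (⟦_⟧ ∘ indicator)
  (dec-false ((c₀ ∷ c) ≟ₗ (a ∷ α)) (ne ∘ List.∷-injectiveˡ))

alt≥-δ-above : ∀ q {a c₀} c → c₀ ℕ.< a → alt≥ q a (δℚ (c₀ ∷ c)) ≡ 0ℚ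
alt≥-δ-above q {a} {c₀} c lt = alt≥-zero q a (δℚ (c₀ ∷ c)) λ b α a≤b →
  D-δ-≢ c α (ℕ.<⇒≢ (ℕ.<-≤-trans lt a≤b))

-- The entry is written `t ℕ.+ a` because the recursion of `alt≥` raises `a` in unit steps, each
-- with a change of sign, until it meets this entry.
alt≥-δ : ∀ t a c → alt≥ (suc t ℕ.+ sum c) a (δℚ (t ℕ.+ a ∷ c)) ≡ sgn t * alt (sum c) (δℚ c)
alt≥-δ zero    a c = trans
  (cong₂ _-_ (alt-cong (sum c) λ α _ → D-δ-≡ a c α) (alt≥-δ-above (sum c) c (ℕ.n<1+n a)))
  (solve 1 (λ x → x :- con 0ℚ := con 1ℚ :* x) refl (alt (sum c) (δℚ c)))
alt≥-δ (suc t) a c = trans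
  (cong₂ _-_
    (alt-zero (suc t ℕ.+ sum c) (D a (δℚ (suc t ℕ.+ a ∷ c))) λ α → D-δ-≢ c α (ℕ.>⇒≢ (ℕ.s≤s (ℕ.m≤n+m a t))))
    (trans (cong (λ x → alt≥ (suc t ℕ.+ sum c) (suc a) (δℚ (x ∷ c))) (sym (ℕ.+-suc t a)))
        (alt≥-δ t (suc a) c)))
  (solve 2 (λ s x → con 0ℚ :- s :* x := (:- s) :* x) refl (sgn t) (alt (sum c) (δℚ c)))

-- Only the composition `c` itself can contribute, and it is a composition only if no entry is 0.
-- The sign (-1)^(n-ℓ) is split into two factors, which avoids truncated subtraction.
alt-δ : ∀ c → alt (sum c) (δℚ c) ≡ sgn (sum c) * (sgn (length c) * ⟦ pos c ⟧)
alt-δ []          = refl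
alt-δ (zero ∷ c)  = trans (vanish (sum c))
  (solve 2 (λ x y → con 0ℚ := x :* (y :* con 0ℚ)) refl (sgn (sum c)) (sgn (suc (length c))))
  where
  vanish : ∀ q → alt q (δℚ (0 ∷ c)) ≡ 0ℚ
  vanish zero    = refl
  vanish (suc q) = alt≥-δ-above (suc q) c (ℕ.s≤s ℕ.z≤n)
alt-δ (suc t ∷ c) = begin
  alt≥ (suc t ℕ.+ sum c) 1 (δℚ (suc t ∷ c))
    ≡⟨ cong (λ x → alt≥ (suc t ℕ.+ sum c) 1 (δℚ (x ∷ c))) (ℕ.+-comm 1 t) ⟩
  alt≥ (suc t ℕ.+ sum c) 1 (δℚ (t ℕ.+ 1 ∷ c))
    ≡⟨ alt≥-δ t 1 c ⟩
  sgn t * alt (sum c) (δℚ c)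
    ≡⟨ cong (sgn t *_) (alt-δ c) ⟩
  sgn t * (sgn (sum c) * (sgn (length c) * ⟦ pos c ⟧))
    ≡⟨ solve 4 (λ t x y p → t :* (x :* (y :* p)) := (:- (t :* x)) :* ((:- y) :* p)) refl
         (sgn t) (sgn (sum c)) (sgn (length c)) ⟦ pos c ⟧ ⟩
  - (sgn t * sgn (sum c)) * (- sgn (length c) * ⟦ pos c ⟧)
    ≡⟨ cong (λ x → - x * (- sgn (length c) * ⟦ pos c ⟧)) (sym (sgn-+ t (sum c))) ⟩
  sgn (suc t ℕ.+ sum c) * (sgn (suc (length c)) * ⟦ pos c ⟧) ∎
  where open ≡-Reasoning

wt≥-δ-above : ∀ q {a c₀} c → c₀ ℕ.< a → wt≥ q a (δℚ (c₀ ∷ c)) ≡ 0ℚ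
wt≥-δ-above q {a} {c₀} c lt = wt≥-zero q a (δℚ (c₀ ∷ c)) λ b α a≤b →
  D-δ-≢ c α (ℕ.<⇒≢ (ℕ.<-≤-trans lt a≤b))

wt≥-δ : ∀ t a c → wt≥ (suc t ℕ.+ sum c) a (δℚ (t ℕ.+ a ∷ c)) ≡ ⟦ t ℕ.+ a ⟧ * (sgn t * alt (sum c) (δℚ c))
wt≥-δ zero    a c = trans
  (cong₂ (λ x y → ⟦ a ⟧ * x - y) (alt-cong (sum c) λ α _ → D-δ-≡ a c α) (wt≥-δ-above (sum c) c (ℕ.n<1+n a)))
  (solve 2 (λ w x → w :* x :- con 0ℚ := w :* (con 1ℚ :* x)) refl ⟦ a ⟧ (alt (sum c) (δℚ c)))
wt≥-δ (suc t) a c = trans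
  (cong₂ (λ x y → ⟦ a ⟧ * x - y)
    (alt-zero (suc t ℕ.+ sum c) (D a (δℚ (suc t ℕ.+ a ∷ c))) λ α → D-δ-≢ c α (ℕ.>⇒≢ (ℕ.s≤s (ℕ.m≤n+m a t))))
    (trans (cong (λ x → wt≥ (suc t ℕ.+ sum c) (suc a) (δℚ (x ∷ c))) (sym (ℕ.+-suc t a)))
      (trans (wt≥-δ t (suc a) c) (cong (λ x → ⟦ x ⟧ * (sgn t * alt (sum c) (δℚ c))) (ℕ.+-suc t a)))))
  (solve 4 (λ v w s x → v :* con 0ℚ :- w :* (s :* x) := w :* ((:- s) :* x)) refl
    ⟦ a ⟧ ⟦ suc t ℕ.+ a ⟧ (sgn t) (alt (sum c) (δℚ c)))

-- The degree is `suc n` and the number of parts is `suc (length c)`; the two shifts by one cancel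
-- in the sign.
wt-δ : ∀ n c₀ c → sum (c₀ ∷ c) ≡ suc n →
      wt (suc n) (δℚ (c₀ ∷ c)) ≡ sgn n * sgn (length c) * ⟦ c₀ ℕ.* pos (c₀ ∷ c) ⟧
wt-δ n zero    c eq = trans (wt≥-δ-above (suc n) {1} c (ℕ.s≤s ℕ.z≤n))
    (sym (ℚ.*-zeroʳ (sgn n * sgn (length c))))
wt-δ n (suc t) c refl = begin
  wt (suc t ℕ.+ sum c) (δℚ (suc t ∷ c))
    ≡⟨ cong (λ x → wt (suc t ℕ.+ sum c) (δℚ (x ∷ c))) (ℕ.+-comm 1 t) ⟩
  wt (suc t ℕ.+ sum c) (δℚ (t ℕ.+ 1 ∷ c))
    ≡⟨ wt≥-δ t 1 c ⟩
  ⟦ t ℕ.+ 1 ⟧ * (sgn t * alt (sum c) (δℚ c))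
    ≡⟨ cong₂ (λ x y → ⟦ x ⟧ * (sgn t * y)) (ℕ.+-comm t 1) (alt-δ c) ⟩
  ⟦ suc t ⟧ * (sgn t * (sgn (sum c) * (sgn (length c) * ⟦ pos c ⟧)))
    ≡⟨ solve 5 (λ w t x y p → w :* (t :* (x :* (y :* p))) := t :* x :* y :* (w :* p)) refl
         ⟦ suc t ⟧ (sgn t) (sgn (sum c)) (sgn (length c)) ⟦ pos c ⟧ ⟩
  sgn t * sgn (sum c) * sgn (length c) * (⟦ suc t ⟧ * ⟦ pos c ⟧)
    ≡⟨ cong₂ (λ x y → x * sgn (length c) * y) (sym (sgn-+ t (sum c))) (sym (⟦⟧-* (suc t) (pos c))) ⟩
  sgn (t ℕ.+ sum c) * sgn (length c) * ⟦ suc t ℕ.* pos c ⟧ ∎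
  where open ≡-Reasoning

⟦⟧-Σ : ∀ {m} (f : Fin m → ℕ) → ⟦ Σℕ.sum f ⟧ ≡ Σℚ.sum (⟦_⟧ ∘ f)
⟦⟧-Σ {zero}  f = refl
⟦⟧-Σ {suc m} f = trans (⟦⟧-+ (f zero) _) (cong (⟦ f zero ⟧ +_) (⟦⟧-Σ (f ∘ suc)))

wt-cong : ∀ n {f g} → f ≗ g → wt n f ≡ wt n g
wt-cong n h = wt≥-cong n 1 λ a α _ → h (a ∷ α)

wt-Σ : ∀ n {m} (f : Fin m → Series) → wt n (λ α → Σℚ.sum λ i → f i α) ≡ Σℚ.sum (λ i → wt n (f i))
wt-Σ n {zero}  f = wt≥-zero n 1 (λ _ → 0ℚ) (λ _ _ _ → refl)
wt-Σ n {suc m} f = begin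
  wt n (λ α → f zero α + Σℚ.sum (λ i → f (suc i) α))
    ≡⟨ wt-cong n (λ α → cong (f zero α +_) (sym (ℚ.*-identityˡ _))) ⟩
  wt n (λ α → f zero α + 1ℚ * Σℚ.sum (λ i → f (suc i) α))
    ≡⟨ wt≥-lin n 1 1ℚ (f zero) (λ α → Σℚ.sum (λ i → f (suc i) α)) ⟩
  wt n (f zero) + 1ℚ * wt n (λ α → Σℚ.sum (λ i → f (suc i) α))
    ≡⟨ cong (wt n (f zero) +_) (trans (ℚ.*-identityˡ _) (wt-Σ n (f ∘ suc))) ⟩
  wt n (f zero) + Σℚ.sum (λ i → wt n (f (suc i))) ∎
  where open ≡-Reasoning

wt-total : ∀ n k {m} s (h : Vec (Fin m) k → List ℕ → ℕ) (w : Vec (Fin m) k → ℕ) →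
  (∀ κ → wt n (λ α → ⟦ h κ α ⟧) ≡ s * ⟦ w κ ⟧) →
  wt n (λ α → ⟦ total k (λ κ → h κ α) ⟧) ≡ s * ⟦ total k w ⟧
wt-total n zero    s h w eq = eq []
wt-total n (suc k) {m} s h w eq = begin
  wt n (λ α → ⟦ Σℕ.sum {m} (λ i → total k (λ κ → h (i ∷ κ) α)) ⟧)
    ≡⟨ wt-cong n (λ α → ⟦⟧-Σ {m} _) ⟩
  wt n (λ α → Σℚ.sum {m} (λ i → ⟦ total k (λ κ → h (i ∷ κ) α) ⟧))
    ≡⟨ wt-Σ n {m} (λ i α → ⟦ total k (λ κ → h (i ∷ κ) α) ⟧) ⟩
  Σℚ.sum {m} (λ i → wt n (λ α → ⟦ total k (λ κ → h (i ∷ κ) α) ⟧))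
    ≡⟨ Σℚ.sum-cong-≗ {m} (λ i → wt-total n k s (h ∘ (i ∷_)) (w ∘ (i ∷_)) (eq ∘ (i ∷_))) ⟩
  Σℚ.sum {m} (λ i → s * ⟦ total k (w ∘ (i ∷_)) ⟧)
    ≡⟨ Σ*ℚ.*-distribˡ-sum {m} s _ ⟨
  s * Σℚ.sum {m} (λ i → ⟦ total k (w ∘ (i ∷_)) ⟧)
    ≡⟨ cong (s *_) (sym (⟦⟧-Σ {m} _)) ⟩
  s * ⟦ total (suc k) w ⟧ ∎
  where open ≡-Reasoning

Σ-single : ∀ {m} (f : Fin m → ℚ) i → (∀ j → j ≢ i → f j ≡ 0ℚ) → Σℚ.sum f ≡ f i
Σ-single {suc m} f i h = trans (Σℚ.sum-remove {i = i} f)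
  (trans (cong (f i +_) (∑-zero {m} _ λ j → h (punchIn i j) (Fin.punchInᵢ≢i i j))) (ℚ.+-identityʳ (f i)))

content : ∀ {m k} → Vec (Fin m) k → List ℕ
content κ = tabulate λ i → count (i Fin.≟_) κ

sum-tabulate : ∀ {m} (f : Fin m → ℕ) → sum (tabulate f) ≡ Σℕ.sum f
sum-tabulate {zero}  f = refl
sum-tabulate {suc m} f = cong (f zero ℕ.+_) (sum-tabulate (f ∘ suc))

tabulate-≡ : ∀ {α : List ℕ} (f : Fin (length α) → ℕ) → tabulate f ≡ α → f ≗ lookup α
tabulate-≡ {_ ∷ _} f eq zero    = List.∷-injectiveˡ eq
tabulate-≡ {_ ∷ _} f eq (suc i) = tabulate-≡ (f ∘ suc) (List.∷-injectiveʳ eq) i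

hasContent⇔ : ∀ {n} α (κ : Vec (Fin (length α)) n) → HasContent α κ ⇔ content κ ≡ α
hasContent⇔ α κ = mk⇔
  (λ h → trans (List.tabulate-cong h) (List.tabulate-lookup α))
  (tabulate-≡ _)

module _ {n : ℕ} (G : Graph (suc n)) where

  isProper : ∀ {m} → Vec (Fin m) (suc n) → ℕ
  isProper κ = indicator (does (proper? G κ))

  -- In `chromaticSeries` the set of colours depends on the exponent list. With `m` fixed the series
  -- becomes a finite sum of monomials, to which the linear functional applies term by term.
  inColours : ℕ → Series
  inColours m α = ⟦ total (suc n) {m} (λ κ → isProper κ ℕ.* δ (content κ) α) ⟧

  ∧-indicator : ∀ x y → indicator (x ∧ y) ≡ indicator x ℕ.* indicator y
  ∧-indicator true  y = sym (ℕ.+-identityʳ _)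
  ∧-indicator false y = refl

  chromatic-inColours : ∀ α → chromaticSeries G α ≡ inColours (length α) α
  chromatic-inColours α = trans (chromatic-number G α) (cong ⟦_⟧ (total-cong (suc n) λ κ →
    trans (∧-indicator (does (proper? G κ)) _) (cong (λ b → isProper κ ℕ.* indicator b)
      (does-⇔ (hasContent⇔ α κ) (hasContent? α κ) (content κ ≟ₗ α)))))

  inColours-≢ : ∀ m α → m ≢ length α → inColours m α ≡ 0ℚ
  inColours-≢ m α ne = cong ⟦_⟧ (total-zero (suc n) {m} λ κ →
    trans (cong (λ b → isProper κ ℕ.* indicator b) (dec-false (content κ ≟ₗ α)
      λ eq → ne (trans (sym (List.length-tabulate _)) (cong length eq)))) (ℕ.*-zeroʳ (isProper κ)))

  chromatic-Σ : ∀ a α → length α ℕ.< suc n →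
    chromaticSeries G (a ∷ α) ≡ Σℚ.sum {suc n} (λ ℓ → inColours (suc (toℕ ℓ)) (a ∷ α))
  chromatic-Σ a α lt = trans (chromatic-inColours (a ∷ α)) (sym (trans
    (Σ-single {suc n} _ (fromℕ< lt) λ j ne → inColours-≢ (suc (toℕ j)) (a ∷ α)
      λ eq → ne (Fin.toℕ-injective (trans (ℕ.suc-injective eq) (sym (Fin.toℕ-fromℕ< lt)))))
    (cong (λ m → inColours (suc m) (a ∷ α)) (Fin.toℕ-fromℕ< lt))))

wt-scale-δ : ∀ n x c → wt n (λ α → ⟦ x ℕ.* δ c α ⟧) ≡ ⟦ x ⟧ * wt n (δℚ c)
wt-scale-δ n x c = begin
  wt n (λ α → ⟦ x ℕ.* δ c α ⟧)
    ≡⟨ wt-cong n (λ α → trans (⟦⟧-* x (δ c α)) (sym (ℚ.+-identityˡ _))) ⟩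
  wt n (λ α → 0ℚ + ⟦ x ⟧ * δℚ c α)
    ≡⟨ wt≥-lin n 1 ⟦ x ⟧ (λ _ → 0ℚ) (δℚ c) ⟩
  wt n (λ _ → 0ℚ) + ⟦ x ⟧ * wt n (δℚ c)
    ≡⟨ cong (_+ ⟦ x ⟧ * wt n (δℚ c)) (wt≥-zero n 1 (λ _ → 0ℚ) (λ _ _ _ → refl)) ⟩
  0ℚ + ⟦ x ⟧ * wt n (δℚ c)
    ≡⟨ ℚ.+-identityˡ _ ⟩
  ⟦ x ⟧ * wt n (δℚ c) ∎
  where open ≡-Reasoning

-- Surjective colourings with a chosen root

Surj : ∀ {m k} → Vec (Fin m) k → Set
Surj κ = ∀ i → ∃[ v ] Vec.lookup κ v ≡ i

surj? : ∀ {m k} (κ : Vec (Fin m) k) → Dec (Surj κ)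
surj? κ = Fin.all? λ i → Fin.any? λ v → Vec.lookup κ v Fin.≟ i

isSurj : ∀ {m k} → Vec (Fin m) k → ℕ
isSurj κ = indicator (does (surj? κ))

isRoot : ∀ {m k} → Fin k → Vec (Fin (suc m)) k → ℕ
isRoot r κ = indicator (does (zero Fin.≟ Vec.lookup κ r))

count-pos : ∀ {m k} (κ : Vec (Fin m) k) i → 0 ℕ.< count (i Fin.≟_) κ ⇔ (∃[ v ] Vec.lookup κ v ≡ i)
count-pos κ i = mk⇔ (to κ) (λ (v , eq) → from κ v eq)
  where
  to : ∀ {k} (κ : Vec _ k) → 0 ℕ.< count (i Fin.≟_) κ → ∃[ v ] Vec.lookup κ v ≡ i
  to (c ∷ κ) p with i Fin.≟ c
  ... | yes eq = zero , sym eq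
  ... | no _ with to κ p
  ...   | v , eq = suc v , eq
  from : ∀ {k} (κ : Vec _ k) v → Vec.lookup κ v ≡ i → 0 ℕ.< count (i Fin.≟_) κ
  from (c ∷ κ) v eq with i Fin.≟ c
  from (c ∷ κ) v       eq | yes _ = ℕ.s≤s ℕ.z≤n
  from (c ∷ κ) zero    eq | no ne = contradiction (sym eq) ne
  from (c ∷ κ) (suc v) eq | no ne = from κ v eq

pos-content : ∀ {m k} (κ : Vec (Fin m) k) → pos (content κ) ≡ isSurj κ
pos-content κ = cong indicator (does-⇔ (mk⇔
  (λ ps i → Equivalence.to (count-pos κ i) (All.tabulate⁻ ps i))
  (λ s → All.tabulate⁺ λ i → Equivalence.from (count-pos κ i) (s i)))
  (All.all? (0 ℕ.<?_) (content κ)) (surj? κ))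

-- This turns the weight α₁ of the functional into a sum over the vertices of the first colour.
count-Σ : ∀ {m k} (κ : Vec (Fin (suc m)) k) → count (zero Fin.≟_) κ ≡ Σℕ.sum (λ r → isRoot r κ)
count-Σ []      = refl
count-Σ (c ∷ κ) with does (zero Fin.≟ c)
... | true  = cong suc (count-Σ κ)
... | false = count-Σ κ

total-Σ : ∀ k {m p} (f : Fin p → Vec (Fin m) k → ℕ) →
  total k (λ κ → Σℕ.sum (λ r → f r κ)) ≡ Σℕ.sum (λ r → total k (f r))
total-Σ zero    f = refl
total-Σ (suc k) {m} {p} f = trans (Σℕ.sum-cong-≗ {m} λ i → total-Σ k (λ r → f r ∘ (i ∷_)))
  (Σℕ.∑-comm {m} {p} _)

-- The surjective colourings with suc ℓ colours that give r the first colour, weighted by φ.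
rooted : ∀ {k} (φ : ∀ {m} → Vec (Fin m) k → ℕ) → Fin k → ℕ → ℕ
rooted {k} φ r ℓ = total k {suc ℓ} λ κ → φ κ ℕ.* (isSurj κ ℕ.* isRoot r κ)

module _ {n : ℕ} (G : Graph (suc n)) where

  wt-inColours : ∀ ℓ → wt (suc n) (inColours G (suc ℓ)) ≡
                  sgn n * sgn ℓ * Σℚ.sum (λ r → ⟦ rooted (isProper G) r ℓ ⟧)
  wt-inColours ℓ = trans (wt-total (suc n) (suc n) (sgn n * sgn ℓ)
      (λ κ α → isProper G κ ℕ.* δ (content κ) α) (λ κ → Σℕ.sum λ r → weight r κ) each)
    (cong (sgn n * sgn ℓ *_) (trans (cong ⟦_⟧ (total-Σ (suc n) weight))
        (⟦⟧-Σ (λ r → total (suc n) (weight r)))))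
    where
    open ≡-Reasoning
    weight : Fin (suc n) → Vec (Fin (suc ℓ)) (suc n) → ℕ
    weight r κ = isProper G κ ℕ.* (isSurj κ ℕ.* isRoot r κ)
    combine : ∀ κ → isProper G κ ℕ.* (count (zero Fin.≟_) κ ℕ.* pos (content κ)) ≡ Σℕ.sum (λ r → weight r κ)
    combine κ = begin
      isProper G κ ℕ.* (count (zero Fin.≟_) κ ℕ.* pos (content κ))
        ≡⟨ cong₂ (λ x y → isProper G κ ℕ.* (x ℕ.* y)) (count-Σ κ) (pos-content κ) ⟩
      isProper G κ ℕ.* (Σℕ.sum (λ r → isRoot r κ) ℕ.* isSurj κ)
        ≡⟨ cong (isProper G κ ℕ.*_) (trans (ℕ.*-comm (Σℕ.sum (λ r → isRoot r κ)) (isSurj κ))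
            (Σ*ℕ.*-distribˡ-sum (isSurj κ) (λ r → isRoot r κ))) ⟩
      isProper G κ ℕ.* Σℕ.sum (λ r → isSurj κ ℕ.* isRoot r κ)
        ≡⟨ Σ*ℕ.*-distribˡ-sum (isProper G κ) (λ r → isSurj κ ℕ.* isRoot r κ) ⟩
      Σℕ.sum (λ r → weight r κ) ∎
    each : ∀ κ → wt (suc n) (λ α → ⟦ isProper G κ ℕ.* δ (content κ) α ⟧) ≡
                 sgn n * sgn ℓ * ⟦ Σℕ.sum (λ r → weight r κ) ⟧
    each κ = begin
      wt (suc n) (λ α → ⟦ isProper G κ ℕ.* δ (content κ) α ⟧)
        ≡⟨ wt-scale-δ (suc n) (isProper G κ) (content κ) ⟩
      ⟦ isProper G κ ⟧ * wt (suc n) (δℚ (content κ))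
        ≡⟨ cong (⟦ isProper G κ ⟧ *_) (wt-δ n _ _
            (trans (sum-tabulate {suc ℓ} (λ i → count (i Fin.≟_) κ)) (sum-count κ))) ⟩
      ⟦ isProper G κ ⟧ * (sgn n * sgn (length c′) * ⟦ count (zero Fin.≟_) κ ℕ.* pos (content κ) ⟧)
        ≡⟨ cong (λ m → ⟦ isProper G κ ⟧ * (sgn n * sgn m * ⟦ count (zero Fin.≟_) κ ℕ.* pos (content κ) ⟧))
            (List.length-tabulate {n = ℓ} _) ⟩
      ⟦ isProper G κ ⟧ * (sgn n * sgn ℓ * ⟦ count (zero Fin.≟_) κ ℕ.* pos (content κ) ⟧)
        ≡⟨ solve 3 (λ x y z → x :* (y :* z) := y :* (x :* z)) refl ⟦ isProper G κ ⟧
            (sgn n * sgn ℓ) ⟦ count (zero Fin.≟_) κ ℕ.* pos (content κ) ⟧ ⟩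
      sgn n * sgn ℓ * (⟦ isProper G κ ⟧ * ⟦ count (zero Fin.≟_) κ ℕ.* pos (content κ) ⟧)
        ≡⟨ cong (sgn n * sgn ℓ *_) (trans (sym (⟦⟧-* (isProper G κ) _)) (cong ⟦_⟧ (combine κ))) ⟩
      sgn n * sgn ℓ * ⟦ Σℕ.sum (λ r → weight r κ) ⟧ ∎
      where
      c′ : List ℕ
      c′ = tabulate {n = ℓ} λ i → count (suc i Fin.≟_) κ

-- The sign is (-1) to the number of vertices minus the number of colours. The range `M` is
-- independent of `k`, so that a graph and its contraction are summed over the same numbers of
-- colours; the terms with more colours than vertices vanish.
signedRooted : ∀ M {k} (φ : ∀ {m} → Vec (Fin m) (suc k) → ℕ) → Fin (suc k) → ℚ
signedRooted M {k} φ r = sgn k * Σℚ.sum {M} (λ ℓ → sgn (toℕ ℓ) * ⟦ rooted φ r (toℕ ℓ) ⟧)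

wt-chromatic : ∀ {n} (G : Graph (suc n)) →
  wt (suc n) (chromaticSeries G) ≡ Σℚ.sum (λ r → signedRooted (suc n) (isProper G) r)
wt-chromatic {n} G = begin
  wt (suc n) (chromaticSeries G)
    ≡⟨ wt≥-cong (suc n) 1 (chromatic-Σ G) ⟩
  wt (suc n) (λ α → Σℚ.sum {suc n} (λ ℓ → inColours G (suc (toℕ ℓ)) α))
    ≡⟨ wt-Σ (suc n) {suc n} (λ ℓ → inColours G (suc (toℕ ℓ))) ⟩
  Σℚ.sum {suc n} (λ ℓ → wt (suc n) (inColours G (suc (toℕ ℓ))))
    ≡⟨ Σℚ.sum-cong-≗ {suc n} (λ ℓ → trans (wt-inColours G (toℕ ℓ))
        (Σ*ℚ.*-distribˡ-sum {suc n} (sgn n * sgn (toℕ ℓ)) (t ℓ))) ⟩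
  Σℚ.sum {suc n} (λ ℓ → Σℚ.sum {suc n} (λ r → sgn n * sgn (toℕ ℓ) * t ℓ r))
    ≡⟨ Σℚ.∑-comm {suc n} {suc n} (λ ℓ r → sgn n * sgn (toℕ ℓ) * t ℓ r) ⟩
  Σℚ.sum {suc n} (λ r → Σℚ.sum {suc n} (λ ℓ → sgn n * sgn (toℕ ℓ) * t ℓ r))
    ≡⟨ Σℚ.sum-cong-≗ {suc n} (λ r → trans
        (Σℚ.sum-cong-≗ {suc n} (λ ℓ → ℚ.*-assoc (sgn n) (sgn (toℕ ℓ)) (t ℓ r)))
         (sym (Σ*ℚ.*-distribˡ-sum {suc n} (sgn n) (λ ℓ → sgn (toℕ ℓ) * t ℓ r)))) ⟩
  Σℚ.sum {suc n} (λ r → signedRooted (suc n) (isProper G) r) ∎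
  where
  open ≡-Reasoning
  t : Fin (suc n) → Fin (suc n) → ℚ
  t ℓ r = ⟦ rooted (isProper G) r (toℕ ℓ) ⟧

-- Deletion and contraction in multigraphs

Edges : ℕ → Set
Edges k = List (Fin k × Fin k)

-- A view of the ends of an edge: a loop, or an end `v` together with the other end named in the
-- complement of `v`, which is what `contract` takes.
data Pair {k : ℕ} : Fin (suc k) → Fin (suc k) → Set where
  equal    : ∀ v → Pair v v
  distinct : ∀ v u → Pair (punchIn v u) v

pair : ∀ {k} (u v : Fin (suc k)) → Pair u v
pair u v with v Fin.≟ u
... | yes refl = equal v
... | no ne    = subst (λ u → Pair u v) (Fin.punchIn-punchOut ne) (distinct v (punchOut ne))

-- Removes the vertex v, identifying it with punchIn v u.
merge : ∀ {k} → Fin (suc k) → Fin k → Fin (suc k) → Fin k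
merge v u x with v Fin.≟ x
... | yes _ = u
... | no ne = punchOut ne

merge-v : ∀ {k} v (u : Fin k) → merge v u v ≡ u
merge-v v u with v Fin.≟ v
... | yes _ = refl
... | no ne = contradiction refl ne

merge-punchIn : ∀ {k} v (u : Fin k) x → merge v u (punchIn v x) ≡ x
merge-punchIn v u x with v Fin.≟ punchIn v x
... | yes eq = contradiction (sym eq) (Fin.punchInᵢ≢i v x)
... | no ne  = trans (Fin.punchOut-cong v refl) (Fin.punchOut-punchIn v)

merge-lift : ∀ {A : Set} {k} v u (χ : Fin (suc k) → A) → χ (punchIn v u) ≡ χ v →
             ∀ x → χ (punchIn v (merge v u x)) ≡ χ x
merge-lift v u χ eq x with v Fin.≟ x
... | yes refl = eq
... | no ne    = cong χ (Fin.punchIn-punchOut ne)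

merge-fibre : ∀ {k} v (u : Fin k) {x y} → merge v u x ≡ merge v u y →
              x ≡ y ⊎ (x ≡ punchIn v u × y ≡ v) ⊎ (x ≡ v × y ≡ punchIn v u)
merge-fibre v u {x} {y} eq with v Fin.≟ x | v Fin.≟ y
... | yes refl | yes refl = inj₁ refl
... | yes refl | no ne    = inj₂ (inj₂ (refl , sym (trans (cong (punchIn v) eq) (Fin.punchIn-punchOut ne))))
... | no ne    | yes refl = inj₂
    (inj₁ (sym (trans (cong (punchIn v) (sym eq)) (Fin.punchIn-punchOut ne)) , refl))
... | no ne    | no ne′   = inj₁ (Fin.punchOut-injective ne ne′ eq)

contract : ∀ {k} → Fin (suc k) → Fin k → Edges (suc k) → Edges k
contract v u = map (Product.map (merge v u) (merge v u))

same differ : ∀ {m k} → Fin k × Fin k → Vec (Fin m) k → ℕ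
same   (u , v) κ = indicator (does (Vec.lookup κ u Fin.≟ Vec.lookup κ v))
differ (u , v) κ = indicator (not (does (Vec.lookup κ u Fin.≟ Vec.lookup κ v)))

respects : ∀ {k} → Edges k → ∀ {m} → Vec (Fin m) k → ℕ
respects []       κ = 1
respects (e ∷ es) κ = differ e κ ℕ.* respects es κ

total-insert : ∀ k {m} (v : Fin (suc k)) (f : Vec (Fin m) (suc k) → ℕ) →
  total (suc k) f ≡ Σℕ.sum (λ c → total k (λ κ → f (insertAt κ v c)))
total-insert k       zero    f = refl
total-insert (suc k) {m} (suc v) f = trans (Σℕ.sum-cong-≗ {m} λ i → total-insert k v (f ∘ (i ∷_)))
  (Σℕ.∑-comm {m} {m} _)

Σℕ-single : ∀ {m} (f : Fin m → ℕ) i → (∀ j → j ≢ i → f j ≡ 0) → Σℕ.sum f ≡ f i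
Σℕ-single {suc m} f i h = trans (Σℕ.sum-remove {i = i} f)
  (trans (cong (f i ℕ.+_) (trans (Σℕ.sum-cong-≗ {m} λ j → h (punchIn i j) (Fin.punchInᵢ≢i i j))
      (Σℕ.sum-replicate-zero m)))
    (ℕ.+-identityʳ (f i)))

-- Once the other vertices are coloured, the colour of `v` is forced to be that of `punchIn v u`.
total-contract : ∀ k {m} v u (ψ : Vec (Fin m) (suc k) → ℕ) →
  total (suc k) (λ κ → same (punchIn v u , v) κ ℕ.* ψ κ) ≡ total k (λ κ → ψ (insertAt κ v (Vec.lookup κ u)))
total-contract k {m} v u ψ = begin
  total (suc k) (λ κ → same (punchIn v u , v) κ ℕ.* ψ κ)
    ≡⟨ total-insert k v (λ κ → same (punchIn v u , v) κ ℕ.* ψ κ) ⟩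
  Σℕ.sum (λ c → total k (λ κ → same (punchIn v u , v) (insertAt κ v c) ℕ.* ψ (insertAt κ v c)))
    ≡⟨ sym (total-Σ k (λ c κ → same (punchIn v u , v) (insertAt κ v c) ℕ.* ψ (insertAt κ v c))) ⟩
  total k (λ κ → Σℕ.sum (λ c → same (punchIn v u , v) (insertAt κ v c) ℕ.* ψ (insertAt κ v c)))
    ≡⟨ total-cong k (λ κ → trans (Σℕ-single _ (Vec.lookup κ u) (others κ)) (chosen κ)) ⟩
  total k (λ κ → ψ (insertAt κ v (Vec.lookup κ u))) ∎
  where
  open ≡-Reasoning
  same-insert : ∀ κ c → same (punchIn v u , v) (insertAt κ v c) ≡ indicator (does (Vec.lookup κ u Fin.≟ c))
  same-insert κ c = cong₂ (λ x y → indicator (does (x Fin.≟ y))) (Vec.insertAt-punchIn κ v c u)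
      (Vec.insertAt-lookup κ v c)
  others : ∀ κ c → c ≢ Vec.lookup κ u → same (punchIn v u , v) (insertAt κ v c) ℕ.* ψ (insertAt κ v c) ≡ 0
  others κ c ne = cong (ℕ._* ψ (insertAt κ v c)) (trans (same-insert κ c)
    (cong indicator (dec-false (Vec.lookup κ u Fin.≟ c) (ne ∘ sym))))
  chosen : ∀ κ → let c = Vec.lookup κ u in same (punchIn v u , v) (insertAt κ v c) ℕ.* ψ (insertAt κ v c)
      ≡ ψ (insertAt κ v c)
  chosen κ = trans (cong (ℕ._* ψ (insertAt κ v (Vec.lookup κ u))) (trans (same-insert κ _)
    (cong indicator (dec-true (Vec.lookup κ u Fin.≟ Vec.lookup κ u) refl)))) (ℕ.*-identityˡ _)

module _ {m k : ℕ} (v : Fin (suc k)) (u : Fin k) (κ : Vec (Fin m) k) where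

  pull : Vec (Fin m) (suc k)
  pull = insertAt κ v (Vec.lookup κ u)

  lookup-pull : ∀ x → Vec.lookup pull x ≡ Vec.lookup κ (merge v u x)
  lookup-pull x with v Fin.≟ x
  ... | yes refl = Vec.insertAt-lookup κ v _
  ... | no ne    = trans (cong (Vec.lookup pull) (sym (Fin.punchIn-punchOut ne)))
      (Vec.insertAt-punchIn κ v _ (punchOut ne))

  respects-pull : ∀ es → respects es pull ≡ respects (contract v u es) κ
  respects-pull []             = refl
  respects-pull ((x , y) ∷ es) = cong₂ ℕ._*_
    (cong₂ (λ a b → indicator (not (does (a Fin.≟ b)))) (lookup-pull x) (lookup-pull y)) (respects-pull es)

  isSurj-pull : isSurj pull ≡ isSurj κ
  isSurj-pull = cong indicator (does-⇔ (mk⇔ to from) (surj? pull) (surj? κ))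
    where
    to : Surj pull → Surj κ
    to s i = let (x , eq) = s i in merge v u x , trans (sym (lookup-pull x)) eq
    from : Surj κ → Surj pull
    from s i = let (x , eq) = s i in punchIn v x , trans (Vec.insertAt-punchIn κ v _ x) eq

isRoot-pull : ∀ {m k} v u (κ : Vec (Fin (suc m)) k) r → isRoot r (pull v u κ) ≡ isRoot (merge v u r) κ
isRoot-pull v u κ r = cong (λ c → indicator (does (zero Fin.≟ c))) (lookup-pull v u κ r)

total-+ : ∀ k {m} (f g : Vec (Fin m) k → ℕ) → total k (λ κ → f κ ℕ.+ g κ) ≡ total k f ℕ.+ total k g
total-+ zero    f g = refl
total-+ (suc k) {m} f g = trans (Σℕ.sum-cong-≗ {m} λ i → total-+ k (f ∘ (i ∷_)) (g ∘ (i ∷_)))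
  (Σℕ.∑-distrib-+ {m} _ _)

-- The colourings are split by whether the two ends agree. Those that agree are pulled back from the
-- contraction, with the same set of colours and the same colour at the root.
deletion-contraction : ∀ {k} v u (es : Edges (suc k)) r ℓ →
  rooted (respects es) r ℓ ≡
  rooted (respects ((punchIn v u , v) ∷ es)) r ℓ ℕ.+ rooted (respects (contract v u es)) (merge v u r) ℓ
deletion-contraction {k} v u es r ℓ = begin
  total (suc k) w
    ≡⟨ total-cong (suc k) (λ κ → split (does (Vec.lookup κ (punchIn v u) Fin.≟ Vec.lookup κ v))
        (respects es κ) (isSurj κ ℕ.* isRoot r κ)) ⟩
  total (suc k) (λ κ → respects ((punchIn v u , v) ∷ es) κ ℕ.* (isSurj κ ℕ.* isRoot r κ)
      ℕ.+ same (punchIn v u , v) κ ℕ.* w κ)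
    ≡⟨ total-+ (suc k) (λ κ → respects ((punchIn v u , v) ∷ es) κ ℕ.* (isSurj κ ℕ.* isRoot r κ))
        (λ κ → same (punchIn v u , v) κ ℕ.* w κ) ⟩
  rooted (respects ((punchIn v u , v) ∷ es)) r ℓ ℕ.+ total (suc k) (λ κ → same (punchIn v u , v) κ ℕ.* w κ)
    ≡⟨ cong (rooted (respects ((punchIn v u , v) ∷ es)) r ℓ ℕ.+_) (trans (total-contract k v u w)
         (total-cong k λ κ → cong₂ ℕ._*_ (respects-pull v u κ es)
             (cong₂ ℕ._*_ (isSurj-pull v u κ) (isRoot-pull v u κ r)))) ⟩
  rooted (respects ((punchIn v u , v) ∷ es)) r ℓ ℕ.+ rooted (respects (contract v u es)) (merge v u r) ℓ ∎
  where
  open ≡-Reasoning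
  w : Vec (Fin (suc ℓ)) (suc k) → ℕ
  w κ = respects es κ ℕ.* (isSurj κ ℕ.* isRoot r κ)
  split : ∀ b x y → x ℕ.* y ≡ indicator (not b) ℕ.* x ℕ.* y ℕ.+ indicator b ℕ.* (x ℕ.* y)
  split true  x y = sym (ℕ.+-identityʳ (x ℕ.* y))
  split false x y = sym (trans (ℕ.+-identityʳ _) (cong (ℕ._* y) (ℕ.+-identityʳ x)))

rooted-loop : ∀ {k} v (es : Edges k) r ℓ → rooted (respects ((v , v) ∷ es)) r ℓ ≡ 0
rooted-loop {k} v es r ℓ = total-zero k λ κ →
  cong (λ b → indicator (not b) ℕ.* respects es κ ℕ.* (isSurj κ ℕ.* isRoot r κ))
      (dec-true (Vec.lookup κ v Fin.≟ Vec.lookup κ v) refl)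

-- Edgeless graphs

surjections : ℕ → ℕ → ℕ
surjections k m = total k {m} isSurj

surjections-< : ∀ {k m} → k ℕ.< m → surjections k m ≡ 0
surjections-< {k} {m} lt = total-zero k λ κ → cong indicator (dec-false (surj? κ) λ s →
  ℕ.<⇒≱ lt (Fin.injective⇒≤ {f = proj₁ ∘ s} λ {i} {j} eq →
    trans (sym (proj₂ (s i))) (trans (cong (Vec.lookup κ) eq) (proj₂ (s j)))))

module _ {m k : ℕ} (r : Fin (suc k)) where

  -- Either `κ` already uses all colours, or the inserted vertex is the only one of colour `zero`;
  -- the two cases exclude each other.
  isSurj-insert : (κ : Vec (Fin (suc m)) k) →
    isSurj (insertAt κ r zero) ≡ isSurj κ
        ℕ.+ indicator (does (count (zero Fin.≟_) κ ℕ.≟ 0)) ℕ.* isSurj (insertAt κ r zero)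
  isSurj-insert κ = by (count (zero Fin.≟_) κ ℕ.≟ 0)
    where
    to : Surj (insertAt κ r zero) → ∃[ v ] Vec.lookup κ v ≡ zero → Surj κ
    to s used i with s i
    ... | x , eq with r Fin.≟ x
    ...   | yes refl = proj₁ used , trans (proj₂ used) (trans (sym (Vec.insertAt-lookup κ r zero)) eq)
    ...   | no r≢x   = punchOut r≢x , trans (sym (Vec.insertAt-punchIn κ r zero (punchOut r≢x)))
              (trans (cong (Vec.lookup (insertAt κ r zero)) (Fin.punchIn-punchOut r≢x)) eq)
    from : Surj κ → Surj (insertAt κ r zero)
    from s i = let (x , eq) = s i in punchIn r x , trans (Vec.insertAt-punchIn κ r zero x) eq
    by : (d : Dec (count (zero Fin.≟_) κ ≡ 0)) →
         isSurj (insertAt κ r zero) ≡ isSurj κ ℕ.+ indicator (does d) ℕ.* isSurj (insertAt κ r zero)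
    by (yes eq) = sym (trans (cong (ℕ._+ (isSurj (insertAt κ r zero) ℕ.+ 0))
        (cong indicator (dec-false (surj? κ)
      λ s → ℕ.<⇒≢ (Equivalence.from (count-pos κ zero) (s zero)) (sym eq)))) (ℕ.+-identityʳ _))
    by (no ne)  = trans (cong indicator
        (does-⇔ (mk⇔ (λ s → to s (Equivalence.to (count-pos κ zero) (ℕ.n≢0⇒n>0 ne))) from)
      (surj? (insertAt κ r zero)) (surj? κ))) (sym (ℕ.+-identityʳ _))

  isSurj-insert-suc : (κ : Vec (Fin m) k) → isSurj (insertAt (Vec.map suc κ) r zero) ≡ isSurj κ
  isSurj-insert-suc κ = cong indicator
      (does-⇔ (mk⇔ to from) (surj? (insertAt (Vec.map suc κ) r zero)) (surj? κ))
    where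
    to : Surj (insertAt (Vec.map suc κ) r zero) → Surj κ
    to s i with s (suc i)
    ... | x , eq with r Fin.≟ x
    ...   | yes refl with trans (sym (Vec.insertAt-lookup (Vec.map suc κ) r zero)) eq
    ...     | ()
    to s i | x , eq | no r≢x = punchOut r≢x , Fin.suc-injective
        (trans (sym (Vec.lookup-map (punchOut r≢x) suc κ))
      (trans (sym (Vec.insertAt-punchIn (Vec.map suc κ) r zero (punchOut r≢x)))
        (trans (cong (Vec.lookup (insertAt (Vec.map suc κ) r zero)) (Fin.punchIn-punchOut r≢x)) eq)))
    from : Surj κ → Surj (insertAt (Vec.map suc κ) r zero)
    from s zero    = r , Vec.insertAt-lookup (Vec.map suc κ) r zero
    from s (suc i) = let (x , eq) = s i in punchIn r x ,
      trans (Vec.insertAt-punchIn (Vec.map suc κ) r zero x) (trans (Vec.lookup-map x suc κ) (cong suc eq))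

count-map-suc : ∀ {m k} (κ : Vec (Fin m) k) → count (zero Fin.≟_) (Vec.map Fin.suc κ) ≡ 0
count-map-suc []      = refl
count-map-suc (_ ∷ κ) = count-map-suc κ

-- The root has the first colour, so the other `k` vertices use either all colours or all but the
-- first.
rooted-edgeless : ∀ {k} (r : Fin (suc k)) ℓ → rooted (respects []) r ℓ
    ≡ surjections k (suc ℓ) ℕ.+ surjections k ℓ
rooted-edgeless {k} r ℓ = begin
  total (suc k) {suc ℓ} (λ κ → 1 ℕ.* (isSurj κ ℕ.* isRoot r κ))
    ≡⟨ total-insert k r (λ κ → 1 ℕ.* (isSurj κ ℕ.* isRoot r κ)) ⟩
  Σℕ.sum {suc ℓ} (λ c → total k (λ κ → 1 ℕ.* (isSurj (insertAt κ r c) ℕ.* isRoot r (insertAt κ r c))))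
    ≡⟨ Σℕ-single {suc ℓ} _ zero (λ c ne → total-zero k λ κ → trans (ℕ.+-identityʳ _)
         (trans (cong (isSurj (insertAt κ r c) ℕ.*_)
             (trans (cong (λ x → indicator (does (zero Fin.≟ x))) (Vec.insertAt-lookup κ r c))
           (cong indicator (dec-false (zero Fin.≟ c) (ne ∘ sym)))))
               (ℕ.*-zeroʳ (isSurj (insertAt κ r c))))) ⟩
  total k (λ κ → 1 ℕ.* (isSurj (insertAt κ r zero) ℕ.* isRoot r (insertAt κ r zero)))
    ≡⟨ total-cong k (λ κ → trans (ℕ.+-identityʳ _)
         (trans (cong (λ x → isSurj (insertAt κ r zero) ℕ.* indicator (does (zero Fin.≟ x)))
             (Vec.insertAt-lookup κ r zero))
           (trans (ℕ.*-identityʳ _) (isSurj-insert r κ)))) ⟩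
  total k (λ κ → isSurj κ ℕ.+ ψ κ)
    ≡⟨ total-+ k isSurj ψ ⟩
  surjections k (suc ℓ) ℕ.+ total k ψ
    -- `ψ` vanishes where colour `zero` is used, so its total runs over the colourings with the `ℓ`
    -- other colours.
    ≡⟨ cong (surjections k (suc ℓ) ℕ.+_) (trans
         (total-unused k ψ (λ κ ne → cong (λ b → indicator b ℕ.* isSurj (insertAt κ r zero))
             (dec-false (count (zero Fin.≟_) κ ℕ.≟ 0) ne)))
         (total-cong k λ κ → trans (cong (λ b → indicator b ℕ.* isSurj (insertAt (Vec.map suc κ) r zero))
           (dec-true (count (zero Fin.≟_) (Vec.map suc κ) ℕ.≟ 0) (count-map-suc κ)))
               (trans (ℕ.+-identityʳ _) (isSurj-insert-suc r κ)))) ⟩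
  surjections k (suc ℓ) ℕ.+ surjections k ℓ ∎
  where
  open ≡-Reasoning
  ψ : Vec (Fin (suc ℓ)) k → ℕ
  ψ κ = indicator (does (count (zero Fin.≟_) κ ℕ.≟ 0)) ℕ.* isSurj (insertAt κ r zero)

-- The factor `c` is there for the induction: shifting `g` by one replaces `c` by `- c`.
Σ-telescope : ∀ M c (g : ℕ → ℕ) →
  Σℚ.sum {M} (λ ℓ → c * (sgn (toℕ ℓ) * ⟦ g (suc (toℕ ℓ)) ℕ.+ g (toℕ ℓ) ⟧)) ≡ c * (⟦ g 0 ⟧ - sgn M * ⟦ g M ⟧)
Σ-telescope zero    c g = solve 2 (λ c x → con 0ℚ := c :* (x :- con 1ℚ :* x)) refl c ⟦ g 0 ⟧
Σ-telescope (suc M) c g = begin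
  c * (1ℚ * ⟦ g 1 ℕ.+ g 0 ⟧) + Σℚ.sum {M}
      (λ ℓ → c * (- sgn (toℕ ℓ) * ⟦ g (suc (suc (toℕ ℓ))) ℕ.+ g (suc (toℕ ℓ)) ⟧))
    ≡⟨ cong₂ _+_ (cong (λ x → c * (1ℚ * x)) (⟦⟧-+ (g 1) (g 0)))
         (trans (Σℚ.sum-cong-≗ {M} (λ ℓ → solve 3 (λ c s x → c :* ((:- s) :* x) := (:- c) :* (s :* x)) refl
             c (sgn (toℕ ℓ)) ⟦ g (suc (suc (toℕ ℓ))) ℕ.+ g (suc (toℕ ℓ)) ⟧))
           (Σ-telescope M (- c) (g ∘ suc))) ⟩
  c * (1ℚ * (⟦ g 1 ⟧ + ⟦ g 0 ⟧)) + - c * (⟦ g 1 ⟧ - sgn M * ⟦ g (suc M) ⟧)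
    ≡⟨ solve 5 (λ c x y s z → c :* (con 1ℚ :* (x :+ y)) :+ (:- c) :* (x :- s :* z)
        := c :* (y :- (:- s) :* z)) refl
         c ⟦ g 1 ⟧ ⟦ g 0 ⟧ (sgn M) ⟦ g (suc M) ⟧ ⟩
  c * (⟦ g 0 ⟧ - sgn (suc M) * ⟦ g (suc M) ⟧) ∎
  where open ≡-Reasoning

module _ (M : ℕ) where

  -- For M > k and loopless es, the number of acyclic orientations of es whose only sink is r.
  abstract
    orientations : ∀ {k} → Edges (suc k) → Fin (suc k) → ℚ
    orientations es r = signedRooted M (respects es) r

    orientations-def : ∀ {k} (es : Edges (suc k)) r → orientations es r ≡ signedRooted M (respects es) r
    orientations-def es r = refl

    -- Of the telescoping sum the upper end vanishes because `M` exceeds `k`. The lower end is 1 for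
    -- `k = 0`, from the empty map, and 0 otherwise, since a nonempty set has no map to the empty
    -- set.
    orientations-edgeless : ∀ {k} (r : Fin (suc k)) → k ℕ.< M → orientations [] r
        ≡ sgn k * ⟦ surjections k 0 ⟧
    orientations-edgeless {k} r lt = begin
      sgn k * Σℚ.sum {M} (λ ℓ → sgn (toℕ ℓ) * ⟦ rooted (respects []) r (toℕ ℓ) ⟧)
        ≡⟨ cong (sgn k *_) (Σℚ.sum-cong-≗ {M} λ ℓ →
            trans (cong (λ x → sgn (toℕ ℓ) * ⟦ x ⟧) (rooted-edgeless r (toℕ ℓ))) (sym (ℚ.*-identityˡ _))) ⟩
      sgn k * Σℚ.sum {M} (λ ℓ → 1ℚ * (sgn
          (toℕ ℓ) * ⟦ surjections k (suc (toℕ ℓ)) ℕ.+ surjections k (toℕ ℓ) ⟧))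
        ≡⟨ cong (sgn k *_) (Σ-telescope M 1ℚ (surjections k)) ⟩
      sgn k * (1ℚ * (⟦ surjections k 0 ⟧ - sgn M * ⟦ surjections k M ⟧))
        ≡⟨ cong (λ x → sgn k * (1ℚ * (⟦ surjections k 0 ⟧ - sgn M * ⟦ x ⟧))) (surjections-< lt) ⟩
      sgn k * (1ℚ * (⟦ surjections k 0 ⟧ - sgn M * 0ℚ))
        ≡⟨ solve 3 (λ c x s → c :* (con 1ℚ :* (x :- s :* con 0ℚ)) := c :* x) refl
            (sgn k) ⟦ surjections k 0 ⟧ (sgn M) ⟩
      sgn k * ⟦ surjections k 0 ⟧ ∎
      where open ≡-Reasoning

    orientations-point : (r : Fin 1) → 0 ℕ.< M → orientations [] r ≡ 1ℚ
    orientations-point r lt = orientations-edgeless r lt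

    orientations-points : ∀ {k} (r : Fin (suc (suc k))) → suc k ℕ.< M → orientations [] r ≡ 0ℚ
    orientations-points {k} r lt = trans (orientations-edgeless r lt) (ℚ.*-zeroʳ (sgn (suc k)))

    orientations-loop : ∀ {k} v (es : Edges (suc k)) r → orientations ((v , v) ∷ es) r ≡ 0ℚ
    orientations-loop {k} v es r = trans
      (cong (sgn k *_) (∑-zero {M} _ λ ℓ →
          trans (cong (λ x → sgn (toℕ ℓ) * ⟦ x ⟧) (rooted-loop v es r (toℕ ℓ))) (ℚ.*-zeroʳ (sgn (toℕ ℓ)))))
      (ℚ.*-zeroʳ (sgn k))

    -- For the colouring counts the contraction is subtracted. It has one vertex fewer, so its sign
    -- is opposite, and here it is added.
    orientations-deletion-contraction : ∀ {k} v u (es : Edges (suc (suc k))) r →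
      orientations ((punchIn v u , v) ∷ es) r
          ≡ orientations es r + orientations (contract v u es) (merge v u r)
    orientations-deletion-contraction {k} v u es r = sym (begin
      sgn (suc k) * Σℚ.sum {M} (λ ℓ → sgn (toℕ ℓ) * ⟦ rooted (respects es) r (toℕ ℓ) ⟧)
          + sgn k * Σℚ.sum {M} c
        ≡⟨ cong (λ x → sgn (suc k) * x + sgn k * Σℚ.sum {M} c) (trans
             (Σℚ.sum-cong-≗ {M} (λ ℓ → trans
               (cong (sgn (toℕ ℓ) *_) (trans (cong ⟦_⟧ (deletion-contraction v u es r (toℕ ℓ)))
                   (⟦⟧-+ (rooted (respects ((punchIn v u , v) ∷ es)) r (toℕ ℓ)) _)))
               (ℚ.*-distribˡ-+ (sgn (toℕ ℓ)) ⟦ rooted (respects ((punchIn v u , v) ∷ es)) r (toℕ ℓ) ⟧ _)))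
             (Σℚ.∑-distrib-+ {M} d c)) ⟩
      - sgn k * (Σℚ.sum {M} d + Σℚ.sum {M} c) + sgn k * Σℚ.sum {M} c
        ≡⟨ solve 3 (λ s x y → (:- s) :* (x :+ y) :+ s :* y := (:- s) :* x) refl (sgn k) (Σℚ.sum {M} d)
            (Σℚ.sum {M} c) ⟩
      - sgn k * Σℚ.sum {M} d ∎)
      where
      open ≡-Reasoning
      c d : Fin M → ℚ
      c ℓ = sgn (toℕ ℓ) * ⟦ rooted (respects (contract v u es)) (merge v u r) (toℕ ℓ) ⟧
      d ℓ = sgn (toℕ ℓ) * ⟦ rooted (respects ((punchIn v u , v) ∷ es)) r (toℕ ℓ) ⟧

-- Connectivity of multigraphs

Invariant : ∀ {A : Set} {k} → (Fin k → A) → Edges k → Set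
Invariant χ = All (uncurry λ x y → χ x ≡ χ y)

-- Two-valued functions constant along the edges replace walks because they transfer along `merge`
-- in both directions (`invariant-lift`, `invariant-merge`).
Connecting : ∀ {k} → Edges k → Set
Connecting {k} es = (χ : Fin k → Bool) → Invariant χ es → ∀ x y → χ x ≡ χ y

Loopless : ∀ {k} → Edges k → Set
Loopless = All (uncurry _≢_)

contract-length : ∀ {k n} v (u : Fin k) es → length es ℕ.≤ n → length (contract v u es) ℕ.≤ n
contract-length {n = n} v u es = subst (ℕ._≤ n) (sym (List.length-map _ es))

invariant-lift : ∀ {A : Set} {k} v u {es} (χ : Fin (suc k) → A) → χ (punchIn v u) ≡ χ v →
  Invariant χ es → Invariant (χ ∘ punchIn v) (contract v u es)
invariant-lift v u χ eq inv = All.map⁺ (All.map (λ {(x , y)} p →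
  trans (merge-lift v u χ eq x) (trans p (sym (merge-lift v u χ eq y)))) inv)

merge-joins : ∀ {k} v (u : Fin k) → merge v u (punchIn v u) ≡ merge v u v
merge-joins v u = trans (merge-punchIn v u u) (sym (merge-v v u))

invariant-merge : ∀ {A : Set} {k} v u {es} (χ : Fin k → A) → Invariant χ (contract v u es) →
  Invariant (χ ∘ merge v u) ((punchIn v u , v) ∷ es)
invariant-merge v u χ inv = cong χ (merge-joins v u) ∷ All.map⁻ inv

connecting-contract : ∀ {k} v (u : Fin k) {es} → Connecting ((punchIn v u , v) ∷ es) →
    Connecting (contract v u es)
connecting-contract v u conn χ inv x y = trans (cong χ (sym (merge-punchIn v u x)))
  (trans (conn (χ ∘ merge v u) (invariant-merge v u χ inv) (punchIn v x) (punchIn v y))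
      (cong χ (merge-punchIn v u y)))

Cut : ∀ {k} → Edges k → Set
Cut {k} es = Σ[ χ ∈ (Fin k → Bool) ] Invariant χ es × ∃[ x ] ∃[ y ] χ x ≢ χ y

connecting-or-cut : ∀ n {k} (es : Edges (suc k)) → length es ℕ.≤ n → Connecting es ⊎ Cut es
connecting-or-cut n {zero} [] le = inj₁ λ { χ _ zero zero → refl }
connecting-or-cut n {suc k} [] le = inj₂
    ((λ { zero → true ; (suc _) → false }) , [] , zero , suc zero , λ ())
connecting-or-cut (suc n) {k} ((u , v) ∷ es) (s≤s le) with pair u v
connecting-or-cut (suc n) {k} (_ ∷ es) (s≤s le) | equal v with connecting-or-cut n es le
... | inj₁ conn             = inj₁ λ { χ (_ ∷ inv) → conn χ inv }
... | inj₂ (χ , inv , ne) = inj₂ (χ , refl ∷ inv , ne)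
connecting-or-cut (suc n) {suc k} (_ ∷ es) (s≤s le) | distinct v u with connecting-or-cut n
    (contract v u es) (contract-length v u es le)
... | inj₁ conn = inj₁ λ { χ (eq ∷ inv) x y → trans (sym (merge-lift v u χ eq x))
        (trans (conn (χ ∘ punchIn v) (invariant-lift v u χ eq inv) (merge v u x) (merge v u y))
            (merge-lift v u χ eq y)) }
... | inj₂ (χ , inv , x , y , ne) = inj₂
    (χ ∘ merge v u , invariant-merge v u χ inv , punchIn v x , punchIn v y ,
        λ eq → ne (trans (cong χ (sym (merge-punchIn v u x))) (trans eq (cong χ (merge-punchIn v u y)))))

-- A new loop could only come from an edge parallel to the contracted one, and along such an edge
-- `χ` would not be constant.
loopless-contract : ∀ {A : Set} {k} v u {es} (χ : Fin (suc k) → A) → χ (punchIn v u) ≢ χ v →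
  Invariant χ es → Loopless es → Loopless (contract v u es)
loopless-contract v u χ ne inv loopless = All.map⁺ (All.zipWith (λ {(x , y)} (p , x≢y) eq →
  [ x≢y , [ (λ { (refl , refl) → ne p }) , (λ { (refl , refl) → ne (sym p) }) ]′ ]′ (merge-fibre v u eq))
      (inv , loopless))

-- Bounds by induction on the edges

0≤1 : 0ℚ ≤ 1ℚ
0≤1 = toWitness {a? = 0ℚ ≤? 1ℚ} _

+-mono-0 : ∀ {c x y} → 0ℚ ≤ x → c ≤ y → c ≤ x + y
+-mono-0 {c} {x} {y} p q = subst (_≤ x + y) (ℚ.+-identityˡ c) (ℚ.+-mono-≤ p q)

+-≤-0 : ∀ {c x y} → x ≡ 0ℚ → y ≤ c → x + y ≤ c
+-≤-0 {c} {x} {y} p q = subst (_≤ c) (trans (sym (ℚ.+-identityˡ y)) (cong (_+ y) (sym p))) q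

module _ (M : ℕ) where

  -- The induction is on the bound `n` for the number of edges, because `contract v u es` is not a
  -- sublist of `es`.
  orientations-nonneg : ∀ n {k} (es : Edges (suc k)) r → k ℕ.< M → length es ℕ.≤ n →
      0ℚ ≤ orientations M es r
  orientations-nonneg n {zero} [] r k<M le = subst (0ℚ ≤_) (sym (orientations-point M r k<M)) 0≤1
  orientations-nonneg n {suc k} [] r k<M le = ℚ.≤-reflexive (sym (orientations-points M r k<M))
  orientations-nonneg (suc n) ((u , v) ∷ es) r k<M (s≤s le) with pair u v
  orientations-nonneg (suc n) (_ ∷ es) r k<M (s≤s le) | equal v =
    ℚ.≤-reflexive (sym (orientations-loop M v es r))
  orientations-nonneg (suc n) {suc k} (_ ∷ es) r k<M (s≤s le) | distinct v u =
    subst (0ℚ ≤_) (sym (orientations-deletion-contraction M v u es r))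
      (+-mono-0 (orientations-nonneg n es r k<M le)
        (orientations-nonneg n (contract v u es) (merge v u r) (ℕ.<⇒≤ k<M) (contract-length v u es le)))

  -- Too few edges to connect the vertices: deletion removes an edge only, contraction an edge and a
  -- vertex, so the deficit lasts until a loop or an edgeless graph on several vertices is reached.
  orientations-sparse : ∀ {k n} (es : Edges (suc k)) r → k ℕ.< M → length es ℕ.≤ n → n ℕ.< k →
      orientations M es r ≡ 0ℚ
  orientations-sparse {suc k} [] r k<M le lt = orientations-points M r k<M
  orientations-sparse {suc k} ((u , v) ∷ es) r k<M (s≤s le) (s≤s lt) with pair u v
  ... | equal v      = orientations-loop M v es r
  ... | distinct v u = trans (orientations-deletion-contraction M v u es r)
    (cong₂ _+_
      (orientations-sparse es r k<M le (ℕ.m≤n⇒m≤1+n lt))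
      (orientations-sparse (contract v u es) (merge v u r) (ℕ.<⇒≤ k<M) (contract-length v u es le) lt))

  -- After a deletion the graph is sparse and counts 0, so the value passes unchanged to the
  -- contraction, ending at a loop, at a single point, or at several points without edges.
  orientations-tree : ∀ {k n} (es : Edges (suc k)) r → k ℕ.< M → length es ℕ.≤ n → n ℕ.≤ k →
      orientations M es r ≤ 1ℚ
  orientations-tree {zero} [] r k<M le lt = ℚ.≤-reflexive (orientations-point M r k<M)
  orientations-tree {suc k} [] r k<M le lt = subst (_≤ 1ℚ) (sym (orientations-points M r k<M)) 0≤1
  orientations-tree {zero} (_ ∷ _) r k<M () z≤n
  orientations-tree {suc k} ((u , v) ∷ es) r k<M (s≤s le) (s≤s lt) with pair u v
  ... | equal v      = subst (_≤ 1ℚ) (sym (orientations-loop M v es r)) 0≤1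
  ... | distinct v u = subst (_≤ 1ℚ) (sym (orientations-deletion-contraction M v u es r))
    (+-≤-0 (orientations-sparse es r k<M le (s≤s lt))
      (orientations-tree (contract v u es) (merge v u r) (ℕ.<⇒≤ k<M) (contract-length v u es le) lt))

  -- Either es is still connecting, or e is a bridge, and then contracting it creates no loop.
  orientations-connecting : ∀ n {k} (es : Edges (suc k)) r → k ℕ.< M → length es ℕ.≤ n →
    Connecting es → Loopless es → 1ℚ ≤ orientations M es r
  orientations-connecting n {zero} [] r k<M le conn loopless = ℚ.≤-reflexive
      (sym (orientations-point M r k<M))
  orientations-connecting n {suc k} [] r k<M le conn loopless
    with conn (λ { zero → true ; (suc _) → false }) [] zero (suc zero)
  ... | ()
  orientations-connecting (suc n) ((u , v) ∷ es) r k<M (s≤s le) conn loopless with pair u v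
  orientations-connecting (suc n) (_ ∷ es) r k<M (s≤s le) conn (ne ∷ _) | equal v = contradiction refl ne
  orientations-connecting (suc n) {suc k} (_ ∷ es) r k<M (s≤s le) conn (_ ∷ loopless) | distinct v u
    with connecting-or-cut n es le
  ... | inj₁ conn′ = subst (1ℚ ≤_) (sym (orientations-deletion-contraction M v u es r))
    (subst (1ℚ ≤_) (ℚ.+-comm (orientations M (contract v u es) (merge v u r)) (orientations M es r))
      (+-mono-0 (orientations-nonneg n (contract v u es) (merge v u r) (ℕ.<⇒≤ k<M)
          (contract-length v u es le))
        (orientations-connecting n es r k<M le conn′ loopless)))
  ... | inj₂ (χ , inv , x , y , ne) = subst (1ℚ ≤_) (sym (orientations-deletion-contraction M v u es r))
    (+-mono-0 (orientations-nonneg n es r k<M le)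
      (orientations-connecting n (contract v u es) (merge v u r) (ℕ.<⇒≤ k<M) (contract-length v u es le)
        (connecting-contract v u conn) (loopless-contract v u χ
            -- If `χ` agreed at the ends of the deleted edge, it would be invariant on the whole
            -- connecting graph, against the cut.
            (λ eq → ne (conn χ (eq ∷ inv) x y)) inv loopless)))

-- The edges of connected graphs and of trees

Joined : ∀ {k} → Edges k → Rel (Fin k) 0ℓ
Joined es x y = (x , y) ∈ es ⊎ (y , x) ∈ es

module _ {n : ℕ} (G : Graph n) where
  open Graph G

  -- The order on the ends makes `edges` list every edge once, as the edge count of a tree requires.
  Edge : Fin n × Fin n → Set
  Edge (u , v) = u Fin.< v × Adjacent u v

  edge? : ∀ e → Dec (Edge e)
  edge? (u , v) = (u Fin.<? v) ×-dec T? (adjacent u v)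

  edges : Edges n
  edges = filter edge? (cartesianProduct (allFin n) (allFin n))

  ∈-edges⁺ : ∀ {u v} → Edge (u , v) → (u , v) ∈ edges
  ∈-edges⁺ {u} {v} = ∈-filter⁺ edge? (∈-cartesianProduct⁺ (∈-allFin u) (∈-allFin v))

  ∈-edges⁻ : ∀ {u v} → (u , v) ∈ edges → Edge (u , v)
  ∈-edges⁻ = proj₂ ∘ ∈-filter⁻ edge? {xs = cartesianProduct (allFin n) (allFin n)}

  adjacent-flip : ∀ {u v} → Adjacent u v → Adjacent v u
  adjacent-flip {u} {v} = subst T (adjacent-sym u v)

  adjacent-joined : ∀ {u v} → Adjacent u v → Joined edges u v
  adjacent-joined {u} {v} a with Fin.<-cmp u v
  ... | tri< u<v _ _  = inj₁ (∈-edges⁺ (u<v , a))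
  ... | tri≈ _ refl _ = contradiction a (subst T (adjacent-irrefl u))
  ... | tri> _ _ v<u  = inj₂ (∈-edges⁺ (v<u , adjacent-flip a))

  edges-loopless : Loopless edges
  edges-loopless = All.tabulate λ i → Fin.<⇒≢ (proj₁ (∈-edges⁻ i))

  edges-unique : Unique edges
  edges-unique = Unique.filter⁺ edge? (Unique.cartesianProduct⁺ (Unique.allFin⁺ n) (Unique.allFin⁺ n))

  edges-connecting : Connected G → Connecting edges
  edges-connecting (_ , walk) χ inv x y = along (walk x y)
    where
    along : ∀ {x y} → Star Adjacent x y → χ x ≡ χ y
    along ε = refl
    along (a ◅ w) with adjacent-joined a
    ... | inj₁ i = trans (All.lookup inv i) (along w)
    ... | inj₂ i = trans (sym (All.lookup inv i)) (along w)

respects-does : ∀ {k} (es : Edges k) {m} (κ : Vec (Fin m) k) →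
  respects es κ ≡ indicator (does (All.all? (λ (u , v) → ¬? (Vec.lookup κ u Fin.≟ Vec.lookup κ v)) es))
respects-does []             κ = refl
respects-does ((u , v) ∷ es) κ with does (Vec.lookup κ u Fin.≟ Vec.lookup κ v)
... | true  = refl
... | false = trans (ℕ.+-identityʳ _) (respects-does es κ)

isProper-edges : ∀ {n} (G : Graph (suc n)) {m} (κ : Vec (Fin m) (suc n)) → isProper G κ
    ≡ respects (edges G) κ
isProper-edges G κ = trans (cong indicator (does-⇔ (mk⇔ to from) (proper? G κ)
    (All.all? (λ (u , v) → ¬? (Vec.lookup κ u Fin.≟ Vec.lookup κ v)) (edges G))))
  (sym (respects-does (edges G) κ))
  where
  Apart : Fin _ × Fin _ → Set
  Apart (u , v) = Vec.lookup κ u ≢ Vec.lookup κ v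
  to : Proper G κ → All Apart (edges G)
  to p = All.tabulate λ {(u , v)} i → p u v (proj₂ (∈-edges⁻ G i))
  from : All Apart (edges G) → Proper G κ
  from ps u v a with adjacent-joined G a
  ... | inj₁ i = All.lookup ps i
  ... | inj₂ i = All.lookup ps i ∘ sym

-- The vertex list is an index, so that simplicity is `Unique vs` and `lookup vs` serves directly as
-- the vertex map of a `Cycle`.
data Path {n : ℕ} (R : Rel (Fin n) 0ℓ) : Fin n → Fin n → List (Fin n) → Set where
  stop : ∀ v → Path R v v (v ∷ [])
  _∷_  : ∀ {u w v vs} → R u w → Path R w v vs → Path R u v (u ∷ vs)

module _ {n : ℕ} {R : Rel (Fin n) 0ℓ} where
  open Data.List.Membership.DecPropositional (Fin._≟_ {n}) using (_∈?_)

  suffix : ∀ {u w v vs} → Path R w v vs → u ∈ vs → Unique vs → ∃[ us ] Path R u v us × Unique us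
  suffix (stop v) (here refl) un       = _ , stop v , un
  suffix (r ∷ p)  (here refl) un       = _ , r ∷ p , un
  suffix (r ∷ p)  (there i)   (_ ∷ un) = suffix p i un

  simplify : ∀ {u v} → Star R u v → ∃[ us ] Path R u v us × Unique us
  simplify {u} ε = _ , stop u , [] ∷ []
  simplify {u} (r ◅ w) with simplify w
  ... | vs , p , un with u ∈? vs
  ...   | yes i = suffix p i un
  ...   | no  i = u ∷ vs , r ∷ p , All.¬Any⇒All¬ vs i ∷ un

  path-step : ∀ {u v y ys} → Path R u v (y ∷ ys) → ∀ i → R (lookup (y ∷ ys) (inject₁ i)) (lookup ys i)
  path-step (r ∷ stop _)    zero    = r
  path-step (r ∷ (_ ∷ _))   zero    = r
  path-step (r ∷ p@(_ ∷ _)) (suc i) = path-step p i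

  path-end : ∀ {u v y ys} → Path R u v (y ∷ ys) → lookup (y ∷ ys) (fromℕ (length ys)) ≡ v
  path-end (stop _)        = refl
  path-end (r ∷ stop _)    = refl
  path-end (r ∷ p@(_ ∷ _)) = path-end p

lookup-injective : ∀ {A : Set} {vs : List A} → Unique vs → Injective _≡_ _≡_ (lookup vs)
lookup-injective (ne ∷ un) {zero}  {zero}  eq = refl
lookup-injective {vs = v ∷ vs} (ne ∷ un) {zero} {suc j} eq = contradiction eq (All.lookup ne (∈-lookup j))
lookup-injective {vs = v ∷ vs} (ne ∷ un) {suc i} {zero} eq = contradiction (sym eq)
    (All.lookup ne (∈-lookup i))
lookup-injective (ne ∷ un) {suc i} {suc j} eq = cong suc (lookup-injective un eq)

module _ {n : ℕ} (G : Graph n) (acyclic : ¬ Cycle G) where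
  open Graph G

  close-path : ∀ {R : Rel (Fin n) 0ℓ} {u v y₀ y₁ y₂ ys} → (∀ {x y} → R x y → Adjacent x y) → Adjacent v u →
               Path R u v (y₀ ∷ y₁ ∷ y₂ ∷ ys) → Unique (y₀ ∷ y₁ ∷ y₂ ∷ ys) → Cycle G
  close-path {u = u} sub a p@(_ ∷ _) un = record
    { distinct = lookup-injective un
    ; step     = λ i → sub (path-step p i)
    ; close    = subst (λ x → Adjacent x u) (sym (path-end p)) a
    }

  -- A simple path from `u` to `v` that cannot be the single step `R u v` has at least three
  -- vertices, and the edge between `v` and `u` closes it to a cycle.
  bridge : ∀ {R : Rel (Fin n) 0ℓ} {u v} → (∀ {x y} → R x y → Adjacent x y) →
           Adjacent u v → ¬ R u v → ¬ Star R u v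
  bridge {R} {u} {v} sub a notR w with simplify w
  ... | _ , stop _ , _ = subst T (adjacent-irrefl u) a
  ... | _ , r ∷ stop _ , _ = notR r
  ... | _ , p@(_ ∷ _ ∷ stop _)  , un = acyclic (close-path sub (adjacent-flip G a) p un)
  ... | _ , p@(_ ∷ _ ∷ _ ∷ _) , un = acyclic (close-path sub (adjacent-flip G a) p un)

  -- π collapses the components of done to points, so each edge of rest lowers the number of points by one.
  forest-size : ∀ {k} (π : Fin n → Fin (suc k)) (done rest : Edges n) →
    All (Edge G) done → All (Edge G) rest → All (λ e → All (e ≢_) done) rest → Unique rest →
    (∀ {x y} → π x ≡ π y → Star (Joined done) x y) → length rest ℕ.≤ k
  forest-size π done [] _ _ _ _ _ = z≤n
  forest-size {k} π done ((u , v) ∷ rest) done⊆E ((u<v , a) ∷ rest⊆E) (e∉done ∷ fresh) (e∉rest ∷ un) sound =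
    by π sound (pair (π u) (π v)) refl refl
    where
    joined⇒adjacent : ∀ {x y} → Joined done x y → Adjacent x y
    joined⇒adjacent (inj₁ i) = proj₂ (All.lookup done⊆E i)
    joined⇒adjacent (inj₂ i) = adjacent-flip G (proj₂ (All.lookup done⊆E i))
    unjoined : ¬ Joined done u v
    unjoined (inj₁ i) = All.lookup e∉done i refl
    unjoined (inj₂ i) = Fin.<-asym u<v (proj₁ (All.lookup done⊆E i))
    by : ∀ {k} (π : Fin n → Fin (suc k)) → (∀ {x y} → π x ≡ π y → Star (Joined done) x y) →
         ∀ {a b} → Pair a b → a ≡ π u → b ≡ π v → suc (length rest) ℕ.≤ k
    -- If `π u` and `π v` coincided, `done` would already join the ends of the new edge.
    by π sound (equal _) p q = contradiction (sound (trans (sym p) q)) (bridge joined⇒adjacent a unjoined)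
    by {suc k} π sound (distinct v′ u′) p q = s≤s (forest-size (merge v′ u′ ∘ π) ((u , v) ∷ done) rest
      ((u<v , a) ∷ done⊆E) rest⊆E (All.zipWith (λ (e≢x , x∉) → (e≢x ∘ sym) ∷ x∉)
          (e∉rest , fresh)) un sound′)
      where
      longer : ∀ {x y} → π x ≡ π y → Star (Joined ((u , v) ∷ done)) x y
      longer eq = Star.map [ inj₁ ∘ there , inj₂ ∘ there ]′ (sound eq)
      sound′ : ∀ {x y} → merge v′ u′ (π x) ≡ merge v′ u′ (π y) → Star (Joined ((u , v) ∷ done)) x y
      sound′ eq with merge-fibre v′ u′ eq
      ... | inj₁ xy              = longer xy
      ... | inj₂ (inj₁ (xu , yv)) = longer (trans xu p) ◅◅ inj₁ (here refl) ◅ longer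
          (trans (sym q) (sym yv))
      ... | inj₂ (inj₂ (xv , yu)) = longer (trans xv q) ◅◅ inj₂ (here refl) ◅ longer
          (trans (sym p) (sym yu))

tree-size : ∀ {n} (G : Graph (suc n)) → ¬ Cycle G → length (edges G) ℕ.≤ n
tree-size G acyclic = forest-size G acyclic id [] (edges G) [] (All.tabulate (∈-edges⁻ G))
  (All.universal (λ _ → []) (edges G)) (edges-unique G) (λ { refl → ε })

-- Comparison of the coefficients

Σ-mono : ∀ {m} (f g : Fin m → ℚ) → (∀ i → f i ≤ g i) → Σℚ.sum f ≤ Σℚ.sum g
Σ-mono {zero}  f g h = ℚ.≤-refl
Σ-mono {suc m} f g h = ℚ.+-mono-≤ (h zero) (Σ-mono (f ∘ suc) (g ∘ suc) (h ∘ suc))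

Σ-one : ∀ m → Σℚ.sum {m} (λ _ → 1ℚ) ≡ ⟦ m ⟧
Σ-one zero    = refl
Σ-one (suc m) = trans (cong (1ℚ +_) (Σ-one m)) (sym (⟦⟧-+ 1 m))

-- Positivity at x₁⋯xₙ

*-nonneg : ∀ {x y} → 0ℚ ≤ x → 0ℚ ≤ y → 0ℚ ≤ x * y
*-nonneg {x} {y} p q = subst (_≤ x * y) (ℚ.*-zeroˡ y) (ℚ.*-monoʳ-≤-nonNeg y {{nonNegative q}} p)

Σ-nonneg : ∀ {m} (f : Fin m → ℚ) → (∀ i → 0ℚ ≤ f i) → 0ℚ ≤ Σℚ.sum f
Σ-nonneg {zero}  f h = ℚ.≤-refl
Σ-nonneg {suc m} f h = +-mono-0 (h zero) (Σ-nonneg (f ∘ suc) (h ∘ suc))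

⊛-nonneg : ∀ {f g} → (∀ α → 0ℚ ≤ f α) → (∀ α → 0ℚ ≤ g α) → ∀ α → 0ℚ ≤ (f ⊛ g) α
⊛-nonneg p q []      = *-nonneg (p []) (q [])
⊛-nonneg p q (a ∷ α) = Σ-nonneg {suc a} _ λ i →
  ⊛-nonneg (λ β → p (Fin.toℕ i ∷ β)) (λ γ → q (a ∸ Fin.toℕ i ∷ γ)) α

e-nonneg : ∀ k α → 0ℚ ≤ e k α
e-nonneg zero    []                = 0≤1
e-nonneg (suc k) []                = ℚ.≤-refl
e-nonneg zero    (zero ∷ α)        = e-nonneg zero α
e-nonneg zero    (suc _ ∷ α)       = ℚ.≤-refl
e-nonneg (suc k) (zero ∷ α)        = e-nonneg (suc k) α
e-nonneg (suc k) (suc zero ∷ α)    = e-nonneg k α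
e-nonneg (suc k) (suc (suc _) ∷ α) = ℚ.≤-refl

eProduct-nonneg : ∀ ν α → 0ℚ ≤ eProduct ν α
eProduct-nonneg []      = e-nonneg 0
eProduct-nonneg (k ∷ ν) = ⊛-nonneg (e-nonneg k) (eProduct-nonneg ν)

-- Giving the first `k` variables to `e k` contributes `g (replicate j 1)`; the other ways to split
-- the monomial contribute nonnegative terms.
e⊛-pos : ∀ k j {d g} → IsSymmetric d g → (∀ α → 0ℚ ≤ g α) → 0ℚ < g (replicate j 1) →
         0ℚ < (e k ⊛ g) (replicate (k ℕ.+ j) 1)
e⊛-pos zero    j {g = g} S nn p = subst (0ℚ <_) (sym (e0-⊛ g (replicate j 1))) p
e⊛-pos (suc k) j {g = g} S nn p = subst (0ℚ <_) (sym (D-e⊛ k 0 g 1s))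
  (ℚ.+-mono-≤-< (⊛-nonneg (e-nonneg (suc k)) (nn ∘ (1 ∷_)) 1s)
    (subst (0ℚ <_) (sym (trans (ℚ.*-identityˡ _)
        (⊛-cong {f = e k} {g = D 0 g} (λ _ → refl) (IsSymmetric.0-stable S) 1s)))
      (e⊛-pos k j S nn p)))
  where
  1s : List ℕ
  1s = replicate (k ℕ.+ j) 1

0<1 : 0ℚ < 1ℚ
0<1 = ℚ.positive⁻¹ 1ℚ

eProduct-pos : ∀ ν → 0ℚ < eProduct ν (replicate (sum ν) 1)
eProduct-pos []      = 0<1
eProduct-pos (k ∷ ν) = e⊛-pos k (sum ν) (eProduct-sym ν) (eProduct-nonneg ν) (eProduct-pos ν)

∑∈-nonneg : ∀ {I : Set} {f : I → ℚ} {L} → All (λ i → 0ℚ ≤ f i) L → 0ℚ ≤ ∑∈ L f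
∑∈-nonneg []       = ℚ.≤-refl
∑∈-nonneg (p ∷ ps) = +-mono-0 p (∑∈-nonneg ps)

∑∈-≤0 : ∀ {I : Set} {f : I → ℚ} {L} → All (λ i → 0ℚ ≤ f i) L → ∑∈ L f ≤ 0ℚ → All (λ i → f i ≤ 0ℚ) L
∑∈-≤0 []       le = []
∑∈-≤0 {f = f} {i ∷ L} (p ∷ ps) le =
  ℚ.≤-trans (subst (f i ≤_) (ℚ.+-comm (∑∈ L f) (f i)) (+-mono-0 (∑∈-nonneg ps) ℚ.≤-refl)) le ∷
  ∑∈-≤0 ps (ℚ.≤-trans (+-mono-0 p ℚ.≤-refl) le)

ePositive-zero : ∀ {n} (F : SymmetricFunction n) → ePositive F → coeff F (replicate n 1) ≤ 0ℚ →
                 ∀ ν → ν ⊢ n → [e ν ] F ≡ 0ℚ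
ePositive-zero {n} F positivity le ν ν⊢ = ℚ.≤-antisym
  (ℚ.*-cancelʳ-≤-pos (eProduct ν 1s) {{positive eν>0}}
      (subst ([e ν ] F * eProduct ν 1s ≤_) (sym (ℚ.*-zeroˡ (eProduct ν 1s))) term≤0))
  (positivity ν ν⊢)
  where
  1s : List ℕ
  1s = replicate n 1
  eν>0 : 0ℚ < eProduct ν 1s
  eν>0 = subst (λ m → 0ℚ < eProduct ν (replicate m 1)) (_⊢_.parts-sum ν⊢) (eProduct-pos ν)
  term≤0 : [e ν ] F * eProduct ν 1s ≤ 0ℚ
  term≤0 = All.lookup (∑∈-≤0
      (All.tabulate λ {κ} i → *-nonneg (positivity κ (Equivalence.to ∈-partitions i))
          (eProduct-nonneg κ 1s))
      (subst (_≤ 0ℚ) (eExpansion.expands (eExpand F) 1s) le))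
    (Equivalence.from ∈-partitions ν⊢)

∑∈-lin : ∀ {I : Set} (L : List I) c (x y : I → ℚ) (z : I → ℚ) →
  ∑∈ L (λ i → x i * z i) - c * ∑∈ L (λ i → y i * z i) ≡ ∑∈ L (λ i → (x i - c * y i) * z i)
∑∈-lin []      c x y z = solve 1 (λ c → con 0ℚ :- c :* con 0ℚ := con 0ℚ) refl c
∑∈-lin (i ∷ L) c x y z = trans
  (solve 6 (λ c x y z s t → (x :* z :+ s) :- c :* (y :* z :+ t) := (x :- c :* y) :* z :+ (s :- c :* t)) refl
    c (x i) (y i) (z i) (∑∈ L (λ i → x i * z i)) (∑∈ L (λ i → y i * z i)))
  (cong ((x i - c * y i) * z i +_) (∑∈-lin L c x y z))

-- `[e ν ]` is computed by elimination, so its linearity is drawn from the uniqueness of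
-- e-expansions.
[e]-sub-scale : ∀ {n} (F K : SymmetricFunction n) c {ν} → ν ⊢ n → [e ν ] (F −[ c ] K)
    ≡ [e ν ] F - c * [e ν ] K
[e]-sub-scale {n} F K c ν⊢ = sym (eExpansion-unique (F −[ c ] K) (record
  { coefficient = λ ν → [e ν ] F - c * [e ν ] K
  ; expands     = λ α → trans
      (cong₂ (λ x y → x - c * y) (eExpansion.expands (eExpand F) α) (eExpansion.expands (eExpand K) α))
      (∑∈-lin (partitions n) c (λ ν → [e ν ] F) (λ ν → [e ν ] K) (λ ν → eProduct ν α))
  }) ν⊢)

÷₀-* : ∀ p {q} → q ≢ 0ℚ → (p ÷₀ q) * q ≡ p
÷₀-* p {q} q≢0 with q ≟ 0ℚ
... | yes q≡0 = contradiction q≡0 q≢0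
... | no _    = trans (ℚ.*-assoc p (1/ q) q) (trans (cong (p *_) (ℚ.*-inverseˡ q)) (ℚ.*-identityʳ p))
  where
  instance
    q-nonZero : NonZero q
    q-nonZero = ≢-nonZero q≢0

count-unique : ∀ {m k} (κ : Vec (Fin m) k) c → count (c Fin.≟_) κ ℕ.≤ 1 →
               ∀ {u v} → Vec.lookup κ u ≡ c → Vec.lookup κ v ≡ c → u ≡ v
count-unique (x ∷ κ) c le {zero}  {zero}  p q = refl
count-unique (x ∷ κ) c le {u}     {v}     p q with c Fin.≟ x
count-unique (x ∷ κ) c le {zero}  {zero}  p q | _ = refl
count-unique (x ∷ κ) c (s≤s le) {zero} {suc v} p q | yes _ =
  contradiction (Equivalence.from (count-pos κ c) (v , q)) (ℕ.≤⇒≯ le)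
count-unique (x ∷ κ) c (s≤s le) {suc u} {v} p q | yes _ =
  contradiction (Equivalence.from (count-pos κ c) (u , p)) (ℕ.≤⇒≯ le)
count-unique (x ∷ κ) c le {zero}  {suc v} p q | no ne = contradiction (sym p) ne
count-unique (x ∷ κ) c le {suc u} {zero}  p q | no ne = contradiction (sym q) ne
count-unique (x ∷ κ) c le {suc u} {suc v} p q | no ne = cong suc (count-unique κ c le p q)

lookup-1s : ∀ n i → lookup (replicate n 1) i ≡ 1
lookup-1s (suc n) zero    = refl
lookup-1s (suc n) (suc i) = lookup-1s n i

-- A colouring with content 1, ..., 1 is injective, hence proper for every graph.
chromatic-1s : ∀ {n} (G H : Graph n) → chromaticSeries G (replicate n 1) ≡ chromaticSeries H (replicate n 1)
chromatic-1s {n} G H = trans (chromatic-number G 1s) (trans (cong ⟦_⟧ (total-cong n λ κ → cong indicator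
    (does-⇔ (mk⇔ (swap-graph G H κ) (swap-graph H G κ)) (contributes? G 1s κ) (contributes? H 1s κ))))
  (sym (chromatic-number H 1s)))
  where
  1s : List ℕ
  1s = replicate n 1
  swap-graph : ∀ G H (κ : Vec (Fin (length 1s)) n) → Contributes G 1s κ → Contributes H 1s κ
  swap-graph G H κ (_ , content) = (λ u v a eq → contradiction
      (subst (λ w → T (Graph.adjacent H u w)) (sym (count-unique κ (Vec.lookup κ v)
        (ℕ.≤-reflexive (trans (content _) (lookup-1s n _))) eq refl)) a)
      (subst T (Graph.adjacent-irrefl H u))) , content

chromatic-nonneg : ∀ {n} (G : Graph n) α → 0ℚ ≤ chromaticSeries G α
chromatic-nonneg G α = subst (0ℚ ≤_) (sym (chromatic-number G α)) (⟦⟧-mono {0} {number G α} z≤n)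

rooted-cong : ∀ {k} {φ ψ : ∀ {m} → Vec (Fin m) k → ℕ} → (∀ {m} (κ : Vec (Fin m) k) → φ κ ≡ ψ κ) →
  ∀ r ℓ → rooted φ r ℓ ≡ rooted ψ r ℓ
rooted-cong {k} h r ℓ = total-cong k λ κ → cong (ℕ._* (isSurj κ ℕ.* isRoot r κ)) (h κ)

signedRooted-cong : ∀ M {k} {φ ψ : ∀ {m} → Vec (Fin m) (suc k) → ℕ} →
    (∀ {m} (κ : Vec (Fin m) (suc k)) → φ κ ≡ ψ κ) →
  ∀ r → signedRooted M φ r ≡ signedRooted M ψ r
signedRooted-cong M {k} {φ} {ψ} h r = cong (sgn k *_) (Σℚ.sum-cong-≗ {M} λ ℓ →
  cong (λ x → sgn (Fin.toℕ ℓ) * ⟦ x ⟧) (rooted-cong {φ = φ} {ψ} h r (Fin.toℕ ℓ)))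

signedRooted-edges : ∀ {n} (G : Graph (suc n)) r → signedRooted (suc n) (isProper G) r
    ≡ orientations (suc n) (edges G) r
signedRooted-edges {n} G r = trans
  (signedRooted-cong (suc n) {φ = isProper G} {respects (edges G)} (isProper-edges G) r)
  (sym (orientations-def (suc n) (edges G) r))

[eₙ]≡orientations : ∀ {n} (G : Graph (suc n)) → [e suc n ∷ [] ] X G
    ≡ Σℚ.sum (orientations (suc n) (edges G))
[eₙ]≡orientations {n} G = trans ([eₙ]≡wt n (X G)) (trans (wt-chromatic G)
  (Σℚ.sum-cong-≗ {suc n} (signedRooted-edges G)))

[eₙ]-connected : ∀ {n} (G : Graph (suc n)) → Connected G → ⟦ suc n ⟧ ≤ [e suc n ∷ [] ] X G
[eₙ]-connected {n} G conn = subst₂ _≤_ (Σ-one (suc n)) (sym ([eₙ]≡orientations G))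
    (Σ-mono {suc n} (λ _ → 1ℚ) (orientations (suc n) (edges G)) λ r →
  orientations-connecting (suc n) (length (edges G)) (edges G) r (ℕ.n<1+n n) ℕ.≤-refl
      (edges-connecting G conn) (edges-loopless G))

[eₙ]-tree : ∀ {n} (G : Graph (suc n)) → IsTree G → [e suc n ∷ [] ] X G ≤ ⟦ suc n ⟧
[eₙ]-tree {n} G tree = subst₂ _≤_ (sym ([eₙ]≡orientations G)) (Σ-one (suc n))
    (Σ-mono {suc n} (orientations (suc n) (edges G)) (λ _ → 1ℚ) λ r →
  orientations-tree (suc n) (edges G) r (ℕ.n<1+n n) ℕ.≤-refl (tree-size G (IsTree.acyclic tree)))

0<⟦suc⟧ : ∀ n → 0ℚ < ⟦ suc n ⟧
0<⟦suc⟧ n = ℚ.<-≤-trans 0<1 (⟦⟧-mono {1} {suc n} (s≤s z≤n))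

*-cancel-one : ∀ {x y} → 0ℚ < y → x * y ≡ y → x ≡ 1ℚ
*-cancel-one {x} {y} y>0 xy≡y = ℚ.≤-antisym
  (ℚ.*-cancelʳ-≤-pos y {{positive y>0}} (ℚ.≤-reflexive (trans xy≡y (sym (ℚ.*-identityˡ y)))))
  (ℚ.*-cancelʳ-≤-pos y {{positive y>0}} (ℚ.≤-reflexive (trans (ℚ.*-identityˡ y) (sym xy≡y))))

÷₀-inverse : ∀ {t h} → 0ℚ < t → 0ℚ < h → (t ÷₀ h) * (h ÷₀ t) ≡ 1ℚ
÷₀-inverse {t} {h} t>0 h>0 = *-cancel-one t>0 (begin
  (t ÷₀ h) * (h ÷₀ t) * t   ≡⟨ ℚ.*-assoc (t ÷₀ h) (h ÷₀ t) t ⟩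
  (t ÷₀ h) * ((h ÷₀ t) * t) ≡⟨ cong ((t ÷₀ h) *_) (÷₀-* h (ℚ.<⇒≢ t>0 ∘ sym)) ⟩
  (t ÷₀ h) * h              ≡⟨ ÷₀-* t (ℚ.<⇒≢ h>0 ∘ sym) ⟩
  t                         ∎)
  where open ≡-Reasoning

1≤÷₀ : ∀ {t h} → 0ℚ < t → t ≤ h → 1ℚ ≤ h ÷₀ t
1≤÷₀ {t} {h} t>0 t≤h = ℚ.*-cancelʳ-≤-pos t {{positive t>0}}
  (subst₂ _≤_ (sym (ℚ.*-identityˡ t)) (sym (÷₀-* h (ℚ.<⇒≢ t>0 ∘ sym))) t≤h)

sub-scale-nonpos : ∀ {p k} → 1ℚ ≤ p → 0ℚ ≤ k → k - p * k ≤ 0ℚ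
sub-scale-nonpos {p} {k} 1≤p 0≤k = subst (k - p * k ≤_) (ℚ.+-inverseʳ (p * k))
  (ℚ.+-monoˡ-≤ (- (p * k)) (subst (_≤ p * k) (ℚ.*-identityˡ k)
      (ℚ.*-monoʳ-≤-nonNeg k {{nonNegative 0≤k}} 1≤p)))

sub-scale-flip : ∀ {p q x y} → q * p ≡ 1ℚ → y - p * x ≡ 0ℚ → x - q * y ≡ 0ℚ
sub-scale-flip {p} {q} {x} {y} qp≡1 y≡px = begin
  x - q * y
    ≡⟨ solve 4 (λ x y p q → x :- q :* y := (con 1ℚ :- q :* p) :* x :- q :* (y :- p :* x)) refl x y p q ⟩
  (1ℚ - q * p) * x - q * (y - p * x)
    ≡⟨ cong₂ (λ a b → (1ℚ - a) * x - q * b) qp≡1 y≡px ⟩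
  (1ℚ - 1ℚ) * x - q * 0ℚ
    ≡⟨ solve 2 (λ x q → (con 1ℚ :- con 1ℚ) :* x :- q :* con 0ℚ := con 0ℚ) refl x q ⟩
  0ℚ ∎
  where open ≡-Reasoning

-- Since `t ≤ h`, the e-positive function is at most 0 at x₁⋯xₙ and therefore vanishes. Then `K` is
-- a multiple of `F`, the opposite combination vanishes too, and zero is e-positive.
ePositive-flip : ∀ {n} (F K : SymmetricFunction n) {t h} → 0ℚ < t → t ≤ h →
  coeff F (replicate n 1) ≡ coeff K (replicate n 1) → 0ℚ ≤ coeff F (replicate n 1) →
  ePositive (K −[ h ÷₀ t ] F) → ePositive (F −[ t ÷₀ h ] K)
ePositive-flip {n} F K {t} {h} t>0 t≤h F≡K F≥0 positivity ν ν⊢ = ℚ.≤-reflexive (sym (begin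
  [e ν ] (F −[ t ÷₀ h ] K)
    ≡⟨ [e]-sub-scale F K (t ÷₀ h) ν⊢ ⟩
  [e ν ] F - (t ÷₀ h) * [e ν ] K
    ≡⟨ sub-scale-flip {h ÷₀ t} {t ÷₀ h} {[e ν ] F} {[e ν ] K} (÷₀-inverse t>0 (ℚ.<-≤-trans t>0 t≤h))
         (trans (sym ([e]-sub-scale K F (h ÷₀ t) ν⊢))
             (ePositive-zero (K −[ h ÷₀ t ] F) positivity nonpositive ν ν⊢)) ⟩
  0ℚ ∎))
  where
  open ≡-Reasoning
  nonpositive : coeff K (replicate n 1) - (h ÷₀ t) * coeff F (replicate n 1) ≤ 0ℚ
  nonpositive = subst (λ k → k - (h ÷₀ t) * coeff F (replicate n 1) ≤ 0ℚ) F≡K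
      (sub-scale-nonpos (1≤÷₀ t>0 t≤h) F≥0)

proposition3p10 : ∀ (n : ℕ) (T : Graph n) (tree : IsTree T) →
    Maximal (_≤ₑ_ {n}) (T , IsTree.connected tree)
proposition3p10 n       T tree (H , conn) (inj₂ H≤T) = H≤T
proposition3p10 zero    T tree (H , () , _) (inj₁ T≤H)
-- `T≤H` says that `Xₑ H T` is e-positive. The bounds for trees and for connected graphs meet at the
-- number of vertices, which gives `t ≤ h`.
proposition3p10 (suc n) T tree (H , conn) (inj₁ T≤H) = ePositive-flip (X T) (X H)
  (ℚ.<-≤-trans (0<⟦suc⟧ n) ([eₙ]-connected T (IsTree.connected tree)))
  (ℚ.≤-trans ([eₙ]-tree T tree) ([eₙ]-connected H conn))
  (chromatic-1s T H) (chromatic-nonneg T (replicate (suc n) 1)) T≤H
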